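{- Let $t$ be a positive integer, let $k,n,p$ be integers with $n=k+p$ and $2\le p\le k-2$, and let $G\in{\rm Cri}_t(k,n)$. If $G$ has no $t$-dominating subgraph belonging to ${\rm Cri}_t(1)\cup{\rm Cri}_t(2)$, then $e(G)\ge t\binom{n}{2}-tp^2$.
   Context: All graphs are finite, undirected, loopless, and may have multiple edges; $e(G)$ is the number of edges of $G$ (with multiplicity). A graph is strictly $t$-degenerate if every non-empty subgraph $H$ has a vertex of degree at most $t-1$ in $H$. $\chi_t(G)$ is the least $k\ge0$ such that $V(G)$ can be colored with $k$ colors so that each color class induces a strictly $t$-degenerate subgraph. $G$ is $\chi_t$-critical if $\chi_t(G')<\chi_t(G)$ for every proper subgraph $G'$; ${\rm Cri}_t(k)$ is the class of $\chi_t$-critical graphs with $\chi_t=k$, and ${\rm Cri}_t(k,n)$ those of order $n$. For disjoint graphs $G_1,G_2$, the Dirac $t$-join $G_1\boxplus^tG_2$ is obtained from $G_1\cup G_2$ by adding, for all $u\in V(G_1)$, $v\in V(G_2)$, exactly $t$ parallel edges between $u$ and $v$. A non-empty subgraph $H$ of $G$ is $t$-dominating if there is a non-empty subgraph $G'$ of $G$ with $G=H\boxplus^t G'$. -}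

module Defs where

open import Data.Nat using (ℕ; _+_; _*_; _≤_; _<_; _<ᵇ_; _≡ᵇ_)
open import Data.Fin using (Fin; toℕ; zero; suc)
open import Data.Nat using () renaming (zero to zeroℕ; suc to sucℕ)
open import Data.Bool using (Bool; true; false; if_then_else_; _∧_)
open import Data.Product using (Σ; ∃; _×_; _,_)
open import Data.Sum using (_⊎_)
open import Relation.Nullary using (¬_)
open import Relation.Binary.PropositionalEquality using (_≡_)

ΣFin : ∀ {n} → (Fin n → ℕ) → ℕ
ΣFin {zeroℕ}  f = 0
ΣFin {sucℕ n} f = f Fin.zero + ΣFin (λ i → f (Fin.suc i))

-- A (loopless, undirected) multigraph whose vertex set is a subset of Fin n.
-- 'mult u v' is the raw multiplicity; only edges between present vertices count
-- (see 'em').  Subgraphs of a graph on Fin n are again of this form.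
record MGraph (n : ℕ) : Set where
  field
    vs     : Fin n → Bool
    mult   : Fin n → Fin n → ℕ
    sym    : ∀ u v → mult u v ≡ mult v u
    loopless : ∀ v → mult v v ≡ 0
open MGraph public

em : ∀ {n} → MGraph n → Fin n → Fin n → ℕ
em H u v = if vs H u ∧ vs H v then mult H u v else 0

_∈V_ : ∀ {n} → Fin n → MGraph n → Set
v ∈V H = vs H v ≡ true

NonEmpty : ∀ {n} → MGraph n → Set
NonEmpty H = ∃ λ v → v ∈V H

_⊆G_ : ∀ {n} → MGraph n → MGraph n → Set
H' ⊆G H = (∀ v → v ∈V H' → v ∈V H) × (∀ u v → em H' u v ≤ em H u v)

_⊂G_ : ∀ {n} → MGraph n → MGraph n → Set
H' ⊂G H = H' ⊆G H × ¬ (H ⊆G H')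

deg : ∀ {n} → MGraph n → Fin n → ℕ
deg H v = ΣFin (em H v)

e : ∀ {n} → MGraph n → ℕ
e H = ΣFin λ u → ΣFin λ v → if toℕ u <ᵇ toℕ v then em H u v else 0

induced : ∀ {n} → MGraph n → (Fin n → Bool) → MGraph n
induced H P = record { vs = λ v → vs H v ∧ P v ; mult = mult H
                     ; sym = sym H ; loopless = loopless H }

StrictlyDegenerate : ∀ {n} → ℕ → MGraph n → Set
StrictlyDegenerate t H =
  ∀ H' → H' ⊆G H → NonEmpty H' → ∃ λ v → v ∈V H' × sucℕ (deg H' v) ≤ t

Colorable : ∀ {n} → ℕ → MGraph n → ℕ → Set
Colorable t H k = Σ (Fin _ → ℕ) λ c →
  (∀ v → v ∈V H → c v < k) ×
  (∀ i → StrictlyDegenerate t (induced H (λ v → c v ≡ᵇ i)))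

ChiEq : ∀ {n} → ℕ → MGraph n → ℕ → Set
ChiEq t H k = Colorable t H k × (∀ j → j < k → ¬ Colorable t H j)

Cri : ∀ {n} → ℕ → ℕ → MGraph n → Set
Cri t k H = ChiEq t H k × (∀ H' → H' ⊂G H → ∃ λ j → j < k × ChiEq t H' j)

DiracJoinEq : ∀ {n} → ℕ → MGraph n → MGraph n → MGraph n → Set
DiracJoinEq t G H G' =
  (∀ v → v ∈V H → ¬ (v ∈V G')) ×
  (∀ v → v ∈V G → v ∈V H ⊎ v ∈V G') ×
  (∀ v → v ∈V H ⊎ v ∈V G' → v ∈V G) ×
  (∀ u v → u ∈V H → v ∈V H → em G u v ≡ em H u v) ×
  (∀ u v → u ∈V G' → v ∈V G' → em G u v ≡ em G' u v) ×
  (∀ u v → u ∈V H → v ∈V G' → em G u v ≡ t)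

Dominating : ∀ {n} → ℕ → MGraph n → MGraph n → Set
Dominating t G H = H ⊆G G × NonEmpty H ×
  (∃ λ G' → G' ⊆G G × NonEmpty G' × DiracJoinEq t G H G')

{-# OPTIONS --safe #-}
-- Call a set of vertices sparse if it induces a strictly t-degenerate subgraph, and link two vertices
-- if they form a sparse pair, i.e. are joined by fewer than t edges.  Only heredity of sparseness is
-- used to split a vertex-critical set X into pairwise unlinked vertex-critical parts with
-- |part| ≥ 2χ(part) − 1.  The point is that an X without an unlinked bipartition satisfies this bound.
-- Otherwise |X| ≤ 2χ(X) − 2; take U ⊆ X critical with χ(U) = χ(X) − 1 and split it by induction into c
-- parts.  Then |X ∖ U| ≤ c and every part is linked to X ∖ U, so Hall's theorem gives a non-empty
-- A ⊆ X ∖ U matched to distinct parts whose only links outside U go to A.  A colouring of X ∖ A extends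
-- to A without new colours, since each matched vertex can share a class with a neighbour in its
-- critical part, contradicting criticality.
--
-- In the splitting of V(G) into parts with n_i vertices and chromatic number k_i, put p_i = n_i − k_i.
-- A part with k_i = 1 would be a dominating K₁, so p_i ≥ 1, and there are at least two parts, so p_i < p.
-- A vertex of part i has degree at least t(k_i − 1) + t(n − n_i) = t(n − 1) − t p_i, and summing with
-- n_i ≤ 2p_i + 1 ≤ 2p gives the claim.
module Submission where

open import Defs
open import Data.Nat using (ℕ; zero; suc; _+_; _*_; _∸_; _^_; _⊓_; _≤_; _<_; _<ᵇ_; _≡ᵇ_; z≤n; s≤s; s≤s⁻¹; _≤?_; _<?_) renaming (_≟_ to _≟ℕ_)
open import Data.Nat.Properties hiding (_≟_)
open import Data.Nat.Combinatorics using (_C_; nCk+nC[k+1]≡[n+1]C[k+1]; nC1≡n)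
open import Data.Nat.Solver using (module +-*-Solver)
open import Data.Fin using (Fin; zero; suc; toℕ)
open import Data.Fin.Properties using (_≟_; any?; toℕ-injective)
open import Data.Fin.Subset using (Subset; Nonempty; ⁅_⁆; _∈_; _∉_; _⊆_; _∪_; _∩_; _─_; _-_; ∣_∣; inside; outside; ⊥; ⊤)
open import Data.Fin.Subset.Properties
open import Data.Vec using ([]; _∷_; tabulate; lookup; there)
open import Data.Vec.Properties using (lookup⇒[]=; []=⇒lookup; lookup∘tabulate)
open import Data.Bool using (true; false; if_then_else_; _∧_; not; T)
open import Data.Bool.Properties using (T-≡)
open import Data.Product using (Σ; ∃; ∃₂; _×_; _,_; proj₁; proj₂)
open import Data.Sum using (_⊎_; inj₁; inj₂; [_,_])
open import Data.Empty using (⊥-elim)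
open import Function using (_∘_; id; case_of_)
open import Function.Bundles using (Equivalence)
open import Relation.Nullary using (¬_; Dec; yes; no; does; contradiction; ¬?)
open import Relation.Nullary.Decidable using (_×-dec_; dec-true; decidable-stable)
open import Relation.Binary.PropositionalEquality using (_≡_; _≢_; refl; cong; cong₂; subst; trans; module ≡-Reasoning) renaming (sym to ≡-sym)
open import Algebra.Properties.CommutativeSemigroup +-commutativeSemigroup using (interchange)
open import Algebra.Properties.CommutativeSemigroup *-commutativeSemigroup using (x∙yz≈y∙xz)
open +-*-Solver using (solve; _:+_; _:*_; _:^_; _:=_; con)

-- Finite subsets and their cardinalities.

subsetOf : ∀ {n} {P : Fin n → Set} → (∀ v → Dec (P v)) → Subset n
subsetOf P? = tabulate (does ∘ P?)

module _ {n} {P : Fin n → Set} (P? : ∀ v → Dec (P v)) where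

  ∈-subsetOf⁺ : ∀ {v} → P v → v ∈ subsetOf P?
  ∈-subsetOf⁺ {v} p = lookup⇒[]= v _ (trans (lookup∘tabulate (does ∘ P?) v) (dec-true (P? v) p))

  ∈-subsetOf⁻ : ∀ {v} → v ∈ subsetOf P? → P v
  ∈-subsetOf⁻ {v} v∈ with P? v | trans (≡-sym (lookup∘tabulate (does ∘ P?) v)) ([]=⇒lookup v∈)
  ... | yes p | _ = p
  ... | no  _ | ()

x∈p─q⇒x∉q : ∀ {n} {x : Fin n} (p q : Subset n) → x ∈ p ─ q → x ∉ q
x∈p─q⇒x∉q (_ ∷ p) (outside ∷ q) (there x∈) (there x∈q) = x∈p─q⇒x∉q p q x∈ x∈q
x∈p─q⇒x∉q (_ ∷ p) (inside  ∷ q) (there x∈) (there x∈q) = x∈p─q⇒x∉q p q x∈ x∈q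

∣p∣≡∣p∩q∣+∣p─q∣ : ∀ {n} (p q : Subset n) → ∣ p ∣ ≡ ∣ p ∩ q ∣ + ∣ p ─ q ∣
∣p∣≡∣p∩q∣+∣p─q∣ []            []            = refl
∣p∣≡∣p∩q∣+∣p─q∣ (inside  ∷ p) (inside  ∷ q) = cong suc (∣p∣≡∣p∩q∣+∣p─q∣ p q)
∣p∣≡∣p∩q∣+∣p─q∣ (inside  ∷ p) (outside ∷ q) =
  trans (cong suc (∣p∣≡∣p∩q∣+∣p─q∣ p q)) (≡-sym (+-suc _ _))
∣p∣≡∣p∩q∣+∣p─q∣ (outside ∷ p) (inside  ∷ q) = ∣p∣≡∣p∩q∣+∣p─q∣ p q
∣p∣≡∣p∩q∣+∣p─q∣ (outside ∷ p) (outside ∷ q) = ∣p∣≡∣p∩q∣+∣p─q∣ p q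

q⊆p⇒∣q∣+∣p─q∣≤∣p∣ : ∀ {n} (p q : Subset n) → q ⊆ p → ∣ q ∣ + ∣ p ─ q ∣ ≤ ∣ p ∣
q⊆p⇒∣q∣+∣p─q∣≤∣p∣ p q q⊆p = begin
  ∣ q ∣ + ∣ p ─ q ∣     ≤⟨ +-monoˡ-≤ _ (p⊆q⇒∣p∣≤∣q∣ (λ x∈ → x∈p∩q⁺ (q⊆p x∈ , x∈))) ⟩
  ∣ p ∩ q ∣ + ∣ p ─ q ∣ ≡⟨ ∣p∣≡∣p∩q∣+∣p─q∣ p q ⟨
  ∣ p ∣                 ∎
  where open ≤-Reasoning

∣p∣≤∣q∣+∣p─q∣ : ∀ {n} (p q : Subset n) → ∣ p ∣ ≤ ∣ q ∣ + ∣ p ─ q ∣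
∣p∣≤∣q∣+∣p─q∣ p q = ≤-trans (≤-reflexive (∣p∣≡∣p∩q∣+∣p─q∣ p q)) (+-monoˡ-≤ _ (∣p∩q∣≤∣q∣ p q))

disjoint⇒∣p∣+∣q∣≤∣p∪q∣ : ∀ {n} (p q : Subset n) → (∀ {x} → x ∈ p → x ∉ q) → ∣ p ∣ + ∣ q ∣ ≤ ∣ p ∪ q ∣
disjoint⇒∣p∣+∣q∣≤∣p∪q∣ p q dis = begin
  ∣ p ∣ + ∣ q ∣           ≡⟨ +-comm ∣ p ∣ _ ⟩
  ∣ q ∣ + ∣ p ∣           ≤⟨ +-monoʳ-≤ ∣ q ∣ (p⊆q⇒∣p∣≤∣q∣ (λ x∈p → x∈p∧x∉q⇒x∈p─q (p⊆p∪q q x∈p) (dis x∈p))) ⟩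
  ∣ q ∣ + ∣ p ∪ q ─ q ∣   ≤⟨ q⊆p⇒∣q∣+∣p─q∣≤∣p∣ (p ∪ q) q (q⊆p∪q p q) ⟩
  ∣ p ∪ q ∣               ∎
  where open ≤-Reasoning

x∈p⇒1≤∣p∣ : ∀ {n} {x : Fin n} (p : Subset n) → x ∈ p → 1 ≤ ∣ p ∣
x∈p⇒1≤∣p∣ {x = x} p x∈p = ≤-trans (≤-reflexive (≡-sym (∣⁅x⁆∣≡1 x)))
  (p⊆q⇒∣p∣≤∣q∣ (λ y∈ → subst (_∈ p) (≡-sym (x∈⁅y⁆⇒x≡y x y∈)) x∈p))

1≤∣p∣⇒Nonempty : ∀ {n} (p : Subset n) → 1 ≤ ∣ p ∣ → Nonempty p
1≤∣p∣⇒Nonempty {n} p 1≤ with nonempty? p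
... | yes ne = ne
... | no ¬ne = contradiction (subst (λ q → 1 ≤ ∣ q ∣) (Empty-unique ¬ne) 1≤)
                 (λ 1≤0 → <-irrefl refl (≤-trans 1≤0 (≤-reflexive (∣⊥∣≡0 n))))

x∈p∪⁅y⁆∧x≢y⇒x∈p : ∀ {n} {x y : Fin n} (p : Subset n) → x ∈ p ∪ ⁅ y ⁆ → x ≢ y → x ∈ p
x∈p∪⁅y⁆∧x≢y⇒x∈p {y = y} p x∈ x≢y = [ id , (λ x∈⁅y⁆ → contradiction (x∈⁅y⁆⇒x≡y y x∈⁅y⁆) x≢y) ] (x∈p∪q⁻ p ⁅ y ⁆ x∈)

x∈p-y⇒x≢y : ∀ {n} {x y : Fin n} (p : Subset n) → x ∈ p - y → x ≢ y
x∈p-y⇒x≢y {x = x} p x∈ refl = x∈p─q⇒x∉q p ⁅ x ⁆ x∈ (x∈⁅x⁆ x)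

-- Hall's theorem and envy-free matchings.

module Matching {n c : ℕ} (E : Fin n → Fin c → Set) (E? : ∀ r j → Dec (E r j)) where

  adj? : (T : Subset n) (j : Fin c) → Dec (∃ λ r → r ∈ T × E r j)
  adj? T j = any? (λ r → (r ∈? T) ×-dec E? r j)

  N : Subset n → Subset c
  N T = subsetOf (adj? T)

  HallCondition : Subset n → Subset c → Set
  HallCondition X Y = ∀ T → T ⊆ X → ∣ T ∣ ≤ ∣ N T ∩ Y ∣

  -- The map `to` is total and constrained only on `X`, so that matchings can be restricted and
  -- glued without carrying membership proofs.
  record Match (X : Subset n) (Y : Subset c) : Set where
    field
      to       : Fin n → Fin c
      to-∈     : ∀ {r} → r ∈ X → to r ∈ Y
      to-E     : ∀ {r} → r ∈ X → E r (to r)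
      to-inj   : ∀ {r s} → r ∈ X → s ∈ X → to r ≡ to s → r ≡ s

  -- Hall's condition for `S ∪ T` gives at least |S| + |T| neighbours in `Y`. At most |T| of them
  -- lie in `N T`, and all others are neighbours of `S`.
  remove-tight : ∀ X Y T → T ⊆ X → ∣ N T ∩ Y ∣ ≤ ∣ T ∣ → HallCondition X Y → HallCondition (X ─ T) (Y ─ N T)
  remove-tight X Y T T⊆X tight hc S S⊆ = +-cancelʳ-≤ (∣ T ∣) _ _ (begin
    ∣ S ∣ + ∣ T ∣
      ≤⟨ disjoint⇒∣p∣+∣q∣≤∣p∪q∣ S T (x∈p─q⇒x∉q X T ∘ S⊆) ⟩
    ∣ S ∪ T ∣
      ≤⟨ hc (S ∪ T) (λ x∈ → [ p─q⊆p X T ∘ S⊆ , T⊆X ] (x∈p∪q⁻ S T x∈)) ⟩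
    ∣ N (S ∪ T) ∩ Y ∣
      ≤⟨ ∣p∣≤∣q∣+∣p─q∣ (N (S ∪ T) ∩ Y) (N T ∩ Y) ⟩
    ∣ N T ∩ Y ∣ + ∣ N (S ∪ T) ∩ Y ─ N T ∩ Y ∣
      ≤⟨ +-mono-≤ tight (p⊆q⇒∣p∣≤∣q∣ new) ⟩
    ∣ T ∣ + ∣ N S ∩ (Y ─ N T) ∣
      ≡⟨ +-comm ∣ T ∣ _ ⟩
    ∣ N S ∩ (Y ─ N T) ∣ + ∣ T ∣ ∎)
    where
    open ≤-Reasoning
    new : N (S ∪ T) ∩ Y ─ N T ∩ Y ⊆ N S ∩ (Y ─ N T)
    new {j} j∈ = x∈p∩q⁺ (j∈NS , x∈p∧x∉q⇒x∈p─q j∈Y j∉NT)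
      where
      j∈NST×Y = x∈p∩q⁻ (N (S ∪ T)) Y (p─q⊆p _ (N T ∩ Y) j∈)
      j∈Y = proj₂ j∈NST×Y
      j∉NT : j ∉ N T
      j∉NT j∈NT = x∈p─q⇒x∉q _ (N T ∩ Y) j∈ (x∈p∩q⁺ (j∈NT , j∈Y))
      j∈NS : j ∈ N S
      j∈NS with ∈-subsetOf⁻ (adj? (S ∪ T)) (proj₁ j∈NST×Y)
      ... | r , r∈ , Erj with x∈p∪q⁻ S T r∈
      ... | inj₁ r∈S = ∈-subsetOf⁺ (adj? S) (r , r∈S , Erj)
      ... | inj₂ r∈T = contradiction (∈-subsetOf⁺ (adj? T) (r , r∈T , Erj)) j∉NT

  ∅-match : Fin c → ∀ X Y → ¬ Nonempty X → Match X Y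
  ∅-match j₀ X Y ¬ne = record
    { to = λ _ → j₀
    ; to-∈ = λ r∈ → contradiction (_ , r∈) ¬ne
    ; to-E = λ r∈ → contradiction (_ , r∈) ¬ne
    ; to-inj = λ r∈ → contradiction (_ , r∈) ¬ne }

  ∪-match : ∀ X Y T → (Match T Y) → Match (X ─ T) (Y ─ N T) → Match X Y
  ∪-match X Y T m₁ m₂ = record { to = to ; to-∈ = to-∈ ; to-E = to-E ; to-inj = to-inj }
    where
    module M₁ = Match m₁
    module M₂ = Match m₂
    to : Fin n → Fin c
    to r with r ∈? T
    ... | yes _ = M₁.to r
    ... | no  _ = M₂.to r
    to-∈ : ∀ {r} → r ∈ X → to r ∈ Y
    to-∈ {r} r∈X with r ∈? T
    ... | yes r∈T = M₁.to-∈ r∈T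
    ... | no  r∉T = p─q⊆p Y (N T) (M₂.to-∈ (x∈p∧x∉q⇒x∈p─q r∈X r∉T))
    to-E : ∀ {r} → r ∈ X → E r (to r)
    to-E {r} r∈X with r ∈? T
    ... | yes r∈T = M₁.to-E r∈T
    ... | no  r∉T = M₂.to-E (x∈p∧x∉q⇒x∈p─q r∈X r∉T)
    apart : ∀ {r s} → r ∈ T → s ∈ X → s ∉ T → M₁.to r ≢ M₂.to s
    apart {r} r∈T s∈X s∉T eq = x∈p─q⇒x∉q Y (N T) (M₂.to-∈ (x∈p∧x∉q⇒x∈p─q s∈X s∉T))
      (∈-subsetOf⁺ (adj? T) (r , r∈T , subst (E r) eq (M₁.to-E r∈T)))
    to-inj : ∀ {r s} → r ∈ X → s ∈ X → to r ≡ to s → r ≡ s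
    to-inj {r} {s} r∈X s∈X eq with r ∈? T | s ∈? T
    ... | yes r∈T | yes s∈T = M₁.to-inj r∈T s∈T eq
    ... | yes r∈T | no  s∉T = contradiction eq (apart r∈T s∈X s∉T)
    ... | no  r∉T | yes s∈T = contradiction (≡-sym eq) (apart s∈T r∈X r∉T)
    ... | no  r∉T | no  s∉T = M₂.to-inj (x∈p∧x∉q⇒x∈p─q r∈X r∉T) (x∈p∧x∉q⇒x∈p─q s∈X s∉T) eq

  insert-match : ∀ X Y x y → y ∈ Y → E x y → Match (X - x) (Y - y) → Match X Y
  insert-match X Y x y y∈Y Exy m = record { to = to ; to-∈ = to-∈ ; to-E = to-E ; to-inj = to-inj }
    where
    module M = Match m
    to : Fin n → Fin c
    to r with r ≟ x
    ... | yes _ = y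
    ... | no  _ = M.to r
    to-∈ : ∀ {r} → r ∈ X → to r ∈ Y
    to-∈ {r} r∈X with r ≟ x
    ... | yes _  = y∈Y
    ... | no r≢x = p─q⊆p Y ⁅ y ⁆ (M.to-∈ (x∈p∧x≢y⇒x∈p-y r∈X r≢x))
    to-E : ∀ {r} → r ∈ X → E r (to r)
    to-E {r} r∈X with r ≟ x
    ... | yes refl = Exy
    ... | no  r≢x  = M.to-E (x∈p∧x≢y⇒x∈p-y r∈X r≢x)
    apart : ∀ {r} → r ∈ X → r ≢ x → M.to r ≢ y
    apart r∈X r≢x = x∈p-y⇒x≢y Y (M.to-∈ (x∈p∧x≢y⇒x∈p-y r∈X r≢x))
    to-inj : ∀ {r s} → r ∈ X → s ∈ X → to r ≡ to s → r ≡ s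
    to-inj {r} {s} r∈X s∈X eq with r ≟ x | s ≟ x
    ... | yes refl | yes refl = refl
    ... | yes _    | no  s≢x  = contradiction (≡-sym eq) (apart s∈X s≢x)
    ... | no  r≢x  | yes _    = contradiction eq (apart r∈X r≢x)
    ... | no  r≢x  | no  s≢x  = M.to-inj (x∈p∧x≢y⇒x∈p-y r∈X r≢x) (x∈p∧x≢y⇒x∈p-y s∈X s≢x) eq

  -- Halmos-Vaughan induction; `b` bounds the recursion and `j₀` is the value of `to` for an empty
  -- `X`. A tight non-empty proper subset splits the problem in two. If there is none, any edge at
  -- `x` may be matched, because losing its end costs other sets at most one neighbour.
  hall : Fin c → ∀ b X Y → ∣ X ∣ ≤ b → HallCondition X Y → Match X Y
  hall j₀ b X Y X≤b hc with nonempty? X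
  ... | no ¬ne = ∅-match j₀ X Y ¬ne
  hall j₀ zero X Y X≤b hc | yes (x , x∈X) = contradiction (≤-trans (x∈p⇒1≤∣p∣ X x∈X) X≤b) (λ ())
  hall j₀ (suc b) X Y X≤b hc | yes (x , x∈X)
    with anySubset? (λ T → (T ⊆? X) ×-dec nonempty? T ×-dec nonempty? (X ─ T) ×-dec (∣ N T ∩ Y ∣ ≤? ∣ T ∣))
  ... | yes (T , T⊆X , (y , y∈T) , (z , z∈) , tight) =
    ∪-match X Y T
      (hall j₀ b T Y
        (s≤s⁻¹ (≤-trans (p⊂q⇒∣p∣<∣q∣ (T⊆X , z , p─q⊆p X T z∈ , x∈p─q⇒x∉q X T z∈)) X≤b))
        (λ S S⊆T → hc S (T⊆X ∘ S⊆T)))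
      (hall j₀ b (X ─ T) (Y ─ N T)
        (s≤s⁻¹ (≤-trans (p∩q≢∅⇒∣p─q∣<∣p∣ X T (y , x∈p∩q⁺ (T⊆X y∈T , y∈T))) X≤b))
        (remove-tight X Y T T⊆X tight hc))
  ... | no ¬tight = insert-match X Y x y y∈Y Exy
      (hall j₀ b (X - x) (Y - y) (s≤s⁻¹ (≤-trans (x∈p⇒∣p-x∣<∣p∣ x∈X) X≤b)) hc′)
    where
    open ≤-Reasoning
    ∃y = 1≤∣p∣⇒Nonempty (N ⁅ x ⁆ ∩ Y) (≤-trans (≤-reflexive (≡-sym (∣⁅x⁆∣≡1 x)))
           (hc ⁅ x ⁆ (λ z∈ → subst (_∈ X) (≡-sym (x∈⁅y⁆⇒x≡y x z∈)) x∈X)))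
    y = proj₁ ∃y
    y∈Y : y ∈ Y
    y∈Y = proj₂ (x∈p∩q⁻ (N ⁅ x ⁆) Y (proj₂ ∃y))
    Exy : E x y
    Exy with ∈-subsetOf⁻ (adj? ⁅ x ⁆) (proj₁ (x∈p∩q⁻ (N ⁅ x ⁆) Y (proj₂ ∃y)))
    ... | r , r∈ , Ery = subst (λ r → E r y) (x∈⁅y⁆⇒x≡y x r∈) Ery
    hc′ : HallCondition (X - x) (Y - y)
    hc′ S S⊆ with nonempty? S
    ... | no ¬ne = ≤-trans (≤-reflexive (trans (cong ∣_∣ (Empty-unique ¬ne)) (∣⊥∣≡0 n))) z≤n
    ... | yes ne with ∣ N S ∩ Y ∣ ≤? ∣ S ∣
    -- `x` lies in `X` but not in `S`, so a tight `S` is one of the excluded proper subsets.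
    ...   | yes tight = ⊥-elim (¬tight (S , (λ z∈ → p─q⊆p X ⁅ x ⁆ (S⊆ z∈)) , ne ,
              (x , x∈p∧x∉q⇒x∈p─q x∈X (λ x∈S → x∈p-y⇒x≢y X (S⊆ x∈S) refl)) , tight))
    ...   | no slack = s≤s⁻¹ (begin
      suc ∣ S ∣                         ≤⟨ ≰⇒> slack ⟩
      ∣ N S ∩ Y ∣                       ≤⟨ ∣p∣≤∣q∣+∣p─q∣ (N S ∩ Y) ⁅ y ⁆ ⟩
      ∣ ⁅ y ⁆ ∣ + ∣ N S ∩ Y - y ∣       ≡⟨ cong (_+ ∣ N S ∩ Y - y ∣) (∣⁅x⁆∣≡1 y) ⟩
      suc ∣ N S ∩ Y - y ∣               ≤⟨ s≤s (p⊆q⇒∣p∣≤∣q∣ sub) ⟩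
      suc ∣ N S ∩ (Y - y) ∣             ∎)
      where
      sub : N S ∩ Y - y ⊆ N S ∩ (Y - y)
      sub z∈ with x∈p∩q⁻ (N S) Y (p─q⊆p _ ⁅ y ⁆ z∈)
      ... | z∈N , z∈Y = x∈p∩q⁺ (z∈N , x∈p∧x∉q⇒x∈p─q z∈Y (x∈p─q⇒x∉q _ ⁅ y ⁆ z∈))

  record EnvyFree (X : Subset n) (Y : Subset c) : Set where
    field
      A        : Subset n
      A⊆X      : A ⊆ X
      nonempty : Nonempty A
      match    : Match A Y
      closed   : ∀ {r s} → r ∈ A → s ∈ X → E s (Match.to match r) → s ∈ A

  -- Under Hall's condition all of `X` is matched. Otherwise a violating `T` is discarded together
  -- with `N T`. Then |X ─ T| < |Y ─ N T|, and `T` has no edge to the surviving part of `Y`, so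
  -- `adj` persists and `closed` carries back to `X`.
  envyFree : ∀ b X Y → ∣ X ∣ ≤ b → Nonempty X → ∣ X ∣ ≤ ∣ Y ∣ →
             (∀ {j} → j ∈ Y → ∃ λ r → r ∈ X × E r j) → EnvyFree X Y
  envyFree zero X Y X≤b (x , x∈X) X≤Y adj = contradiction (≤-trans (x∈p⇒1≤∣p∣ X x∈X) X≤b) (λ ())
  envyFree (suc b) X Y X≤b (x , x∈X) X≤Y adj
    with anySubset? (λ T → (T ⊆? X) ×-dec (∣ N T ∩ Y ∣ <? ∣ T ∣))
  ... | no ¬T = record
    { A = X ; A⊆X = id ; nonempty = x , x∈X
    ; match = hall (proj₁ (1≤∣p∣⇒Nonempty Y (≤-trans (x∈p⇒1≤∣p∣ X x∈X) X≤Y))) (suc b) X Y X≤b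
                (λ T T⊆X → ≮⇒≥ (λ lt → ¬T (T , T⊆X , lt)))
    ; closed = λ _ s∈X _ → s∈X }
  ... | yes (T , T⊆X , lt) = record
    { A = R.A ; A⊆X = p─q⊆p X T ∘ R.A⊆X ; nonempty = R.nonempty
    ; match = record { to = M.to ; to-∈ = p─q⊆p Y (N T) ∘ M.to-∈ ; to-E = M.to-E ; to-inj = M.to-inj }
    ; closed = λ r∈A s∈X Es → R.closed r∈A (x∈p∧x∉q⇒x∈p─q s∈X
        (λ s∈T → x∈p─q⇒x∉q Y (N T) (M.to-∈ r∈A) (∈-subsetOf⁺ (adj? T) (_ , s∈T , Es)))) Es }
    where
    open ≤-Reasoning
    X′<Y′ : ∣ X ─ T ∣ < ∣ Y ─ N T ∣
    X′<Y′ = +-cancelˡ-< ∣ T ∣ _ _ (begin-strict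
      ∣ T ∣ + ∣ X ─ T ∣           ≤⟨ q⊆p⇒∣q∣+∣p─q∣≤∣p∣ X T T⊆X ⟩
      ∣ X ∣                       ≤⟨ X≤Y ⟩
      ∣ Y ∣                       ≡⟨ ∣p∣≡∣p∩q∣+∣p─q∣ Y (N T) ⟩
      ∣ Y ∩ N T ∣ + ∣ Y ─ N T ∣   ≤⟨ +-monoˡ-≤ _ (p⊆q⇒∣p∣≤∣q∣ (λ z∈ → case x∈p∩q⁻ Y (N T) z∈ of λ (a , b) → x∈p∩q⁺ (b , a))) ⟩
      ∣ N T ∩ Y ∣ + ∣ Y ─ N T ∣   <⟨ +-monoˡ-< _ lt ⟩
      ∣ T ∣ + ∣ Y ─ N T ∣         ∎)
    adj′ : ∀ {j} → j ∈ Y ─ N T → ∃ λ r → r ∈ X ─ T × E r j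
    adj′ {j} j∈ with adj (p─q⊆p Y (N T) j∈)
    ... | r , r∈X , Erj = r , x∈p∧x∉q⇒x∈p─q r∈X
            (λ r∈T → x∈p─q⇒x∉q Y (N T) j∈ (∈-subsetOf⁺ (adj? T) (r , r∈T , Erj))) , Erj
    -- The strict inequality makes `Y ─ N T` non-empty; a neighbour of one of its elements then
    -- shows that `X ─ T` is non-empty.
    j∈Y′ = 1≤∣p∣⇒Nonempty (Y ─ N T) (≤-trans (s≤s z≤n) X′<Y′)
    t∈T = proj₂ (1≤∣p∣⇒Nonempty T (≤-trans (s≤s z≤n) lt))
    rec = envyFree b (X ─ T) (Y ─ N T)
      (s≤s⁻¹ (≤-trans (p∩q≢∅⇒∣p─q∣<∣p∣ X T (_ , x∈p∩q⁺ (T⊆X t∈T , t∈T))) X≤b))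
      (case adj′ (proj₂ j∈Y′) of λ (r , r∈ , _) → r , r∈)
      (<⇒≤ X′<Y′) adj′
    module R = EnvyFree rec
    module M = Match R.match

-- Finite sums.

ΣFin-mono : ∀ {n} {f g : Fin n → ℕ} → (∀ i → f i ≤ g i) → ΣFin f ≤ ΣFin g
ΣFin-mono {zero}  f≤g = z≤n
ΣFin-mono {suc n} f≤g = +-mono-≤ (f≤g zero) (ΣFin-mono (f≤g ∘ suc))

ΣFin-cong : ∀ {n} {f g : Fin n → ℕ} → (∀ i → f i ≡ g i) → ΣFin f ≡ ΣFin g
ΣFin-cong {zero}  f≡g = refl
ΣFin-cong {suc n} f≡g = cong₂ _+_ (f≡g zero) (ΣFin-cong (f≡g ∘ suc))

ΣFin-+ : ∀ {n} (f g : Fin n → ℕ) → ΣFin (λ i → f i + g i) ≡ ΣFin f + ΣFin g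
ΣFin-+ {zero}  f g = refl
ΣFin-+ {suc n} f g = trans (cong (f zero + g zero +_) (ΣFin-+ (f ∘ suc) (g ∘ suc)))
                           (interchange (f zero) (g zero) _ _)

ΣFin-const : ∀ n a → ΣFin {n} (λ _ → a) ≡ n * a
ΣFin-const zero    a = refl
ΣFin-const (suc n) a = cong (a +_) (ΣFin-const n a)

-- Colourings with classes from a hereditary family.

module Hereditary {n : ℕ} (F : Subset n → Set) (F? : ∀ S → Dec (F S))
  (F-⊆ : ∀ S T → S ⊆ T → F T → F S) (F-⊥ : F ⊥) (F-⁅⁆ : ∀ v → F ⁅ v ⁆) where

  -- Classes are peeled off one by one and may extend beyond `X`, so the same classes colour every
  -- subset of `X`. As `F` is decidable, so is `Col`, which permits classical case distinctions.
  Col : ℕ → Subset n → Set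
  Col zero    X = ¬ Nonempty X
  Col (suc m) X = ∃ λ P → F P × Col m (X ─ P)

  Col? : ∀ m X → Dec (Col m X)
  Col? zero    X = ¬? (nonempty? X)
  Col? (suc m) X = anySubset? (λ P → F? P ×-dec Col? m (X ─ P))

  ─-monoˡ : ∀ {X Y : Subset n} P → X ⊆ Y → X ─ P ⊆ Y ─ P
  ─-monoˡ {X} P X⊆Y x∈ = x∈p∧x∉q⇒x∈p─q (X⊆Y (p─q⊆p X P x∈)) (x∈p─q⇒x∉q X P x∈)

  Col-⊆ : ∀ m {X Y} → X ⊆ Y → Col m Y → Col m X
  Col-⊆ zero    X⊆Y ¬ne (x , x∈X) = ¬ne (x , X⊆Y x∈X)
  Col-⊆ (suc m) {X} {Y} X⊆Y (P , FP , col) = P , FP , Col-⊆ m (─-monoˡ P X⊆Y) col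

  Col-suc : ∀ m {X} → Col m X → Col (suc m) X
  Col-suc m {X} col = ⊥ , F-⊥ , Col-⊆ m (p─q⊆p X ⊥) col

  Col-≤′ : ∀ d m {X} → Col m X → Col (d + m) X
  Col-≤′ zero    m col = col
  Col-≤′ (suc d) m col = Col-suc (d + m) (Col-≤′ d m col)

  Col-≤ : ∀ {m m′ X} → m ≤ m′ → Col m X → Col m′ X
  Col-≤ {m} {m′} {X} m≤ col = subst (λ k → Col k X) (m∸n+n≡m m≤) (Col-≤′ (m′ ∸ m) m col)

  Col-empty : ∀ m {X} → ¬ Nonempty X → Col m X
  Col-empty m = Col-≤ {0} {m} z≤n

  Col-∪ : ∀ a b {X Y} → Col a X → Col b Y → Col (a + b) (X ∪ Y)
  Col-∪ zero    b {X} {Y} ¬ne col =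
    Col-⊆ b (λ x∈ → [ (λ x∈X → contradiction (_ , x∈X) ¬ne) , id ] (x∈p∪q⁻ X Y x∈)) col
  Col-∪ (suc a) b {X} {Y} (P , FP , colX) colY = P , FP , Col-⊆ (a + b) sub (Col-∪ a b colX colY)
    where
    sub : X ∪ Y ─ P ⊆ (X ─ P) ∪ Y
    sub x∈ with x∈p∪q⁻ X Y (p─q⊆p (X ∪ Y) P x∈)
    ... | inj₁ x∈X = x∈p∪q⁺ (inj₁ (x∈p∧x∉q⇒x∈p─q x∈X (x∈p─q⇒x∉q (X ∪ Y) P x∈)))
    ... | inj₂ x∈Y = x∈p∪q⁺ (inj₂ x∈Y)

  -- Linked pairs and unlinked unions.

  Linked : Fin n → Fin n → Set
  Linked u v = F (⁅ u ⁆ ∪ ⁅ v ⁆)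

  ⁅u⁆∪⁅v⁆⊆ : ∀ {u v} (P : Subset n) → u ∈ P → v ∈ P → ⁅ u ⁆ ∪ ⁅ v ⁆ ⊆ P
  ⁅u⁆∪⁅v⁆⊆ {u} {v} P u∈P v∈P x∈ with x∈p∪q⁻ ⁅ u ⁆ ⁅ v ⁆ x∈
  ... | inj₁ x∈u = subst (_∈ P) (≡-sym (x∈⁅y⁆⇒x≡y u x∈u)) u∈P
  ... | inj₂ x∈v = subst (_∈ P) (≡-sym (x∈⁅y⁆⇒x≡y v x∈v)) v∈P

  F⇒Linked : ∀ {u v} P → F P → u ∈ P → v ∈ P → Linked u v
  F⇒Linked P FP u∈P v∈P = F-⊆ _ P (⁅u⁆∪⁅v⁆⊆ P u∈P v∈P) FP

  Linked-sym : ∀ {u v} → Linked u v → Linked v u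
  Linked-sym {u} {v} uv = F⇒Linked (⁅ u ⁆ ∪ ⁅ v ⁆) uv (q⊆p∪q ⁅ u ⁆ ⁅ v ⁆ (x∈⁅x⁆ v)) (p⊆p∪q ⁅ v ⁆ (x∈⁅x⁆ u))

  NoCross : Subset n → Subset n → Set
  NoCross S T = ∀ {u v} → u ∈ S → v ∈ T → ¬ Linked u v

  NoCross-⊆ : ∀ {S S′ T T′} → S′ ⊆ S → T′ ⊆ T → NoCross S T → NoCross S′ T′
  NoCross-⊆ S⊆ T⊆ nc u∈ v∈ = nc (S⊆ u∈) (T⊆ v∈)

  crossing? : ∀ S T → Dec (∃₂ λ u v → u ∈ S × v ∈ T × Linked u v)
  crossing? S T = any? (λ u → any? (λ v → (u ∈? S) ×-dec (v ∈? T) ×-dec F? (⁅ u ⁆ ∪ ⁅ v ⁆)))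

  NoCross? : ∀ S T → Dec (NoCross S T)
  NoCross? S T with crossing? S T
  ... | yes (u , v , u∈ , v∈ , l) = no (λ nc → nc u∈ v∈ l)
  ... | no ¬c = yes (λ u∈ v∈ l → ¬c (_ , _ , u∈ , v∈ , l))

  -- A colour class meeting both sides would contain a linked crossing pair.
  split : ∀ m S T → NoCross S T → Col m (S ∪ T) → ∃₂ λ a b → a + b ≡ m × Col a S × Col b T
  split zero    S T nc ¬ne = 0 , 0 , refl , (λ (x , x∈) → ¬ne (x , p⊆p∪q T x∈)) , (λ (x , x∈) → ¬ne (x , q⊆p∪q S T x∈))
  split (suc m) S T nc (P , FP , col) with nonempty? (S ∩ P)
  ... | yes (s , s∈) with split m (S ─ P) T (NoCross-⊆ (p─q⊆p S P) id nc) (Col-⊆ m sub col)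
    where
    s∈S×P = x∈p∩q⁻ S P s∈
    sub : (S ─ P) ∪ T ⊆ S ∪ T ─ P
    sub x∈ with x∈p∪q⁻ (S ─ P) T x∈
    ... | inj₁ x∈S─P = ─-monoˡ P (p⊆p∪q T) x∈S─P
    ... | inj₂ x∈T   = x∈p∧x∉q⇒x∈p─q (q⊆p∪q S T x∈T)
                         (λ x∈P → nc (proj₁ s∈S×P) x∈T (F⇒Linked P FP (proj₂ s∈S×P) x∈P))
  ...   | a , b , a+b≡m , colS , colT = suc a , b , cong suc a+b≡m , (P , FP , colS) , colT
  split (suc m) S T nc (P , FP , col) | no S∩P=∅ with split m S (T ─ P) (NoCross-⊆ id (p─q⊆p T P) nc) (Col-⊆ m sub col)
    where
    sub : S ∪ (T ─ P) ⊆ S ∪ T ─ P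
    sub x∈ with x∈p∪q⁻ S (T ─ P) x∈
    ... | inj₁ x∈S   = x∈p∧x∉q⇒x∈p─q (p⊆p∪q T x∈S) (λ x∈P → S∩P=∅ (_ , x∈p∩q⁺ (x∈S , x∈P)))
    ... | inj₂ x∈T─P = ─-monoˡ P (q⊆p∪q S T) x∈T─P
  ...   | a , b , a+b≡m , colS , colT = a , suc b , trans (+-suc a b) (cong suc a+b≡m) , colS , (P , FP , colT)

  join : ∀ {c} → (Fin c → Subset n) → Subset n → Subset n
  join {zero}  U Z = Z
  join {suc c} U Z = U zero ∪ join (U ∘ suc) Z

  ∈-join⁺ˡ : ∀ {c} (U : Fin c → Subset n) Z i → U i ⊆ join U Z
  ∈-join⁺ˡ U Z zero    x∈ = p⊆p∪q _ x∈
  ∈-join⁺ˡ U Z (suc i) x∈ = q⊆p∪q (U zero) _ (∈-join⁺ˡ (U ∘ suc) Z i x∈)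

  ∈-join⁺ʳ : ∀ {c} (U : Fin c → Subset n) Z → Z ⊆ join U Z
  ∈-join⁺ʳ {zero}  U Z x∈ = x∈
  ∈-join⁺ʳ {suc c} U Z x∈ = q⊆p∪q (U zero) _ (∈-join⁺ʳ (U ∘ suc) Z x∈)

  ∈-join⁻ : ∀ {c} (U : Fin c → Subset n) Z {x} → x ∈ join U Z → (∃ λ i → x ∈ U i) ⊎ x ∈ Z
  ∈-join⁻ {zero}  U Z x∈ = inj₂ x∈
  ∈-join⁻ {suc c} U Z x∈ with x∈p∪q⁻ (U zero) _ x∈
  ... | inj₁ x∈U = inj₁ (zero , x∈U)
  ... | inj₂ x∈J with ∈-join⁻ (U ∘ suc) Z x∈J
  ...   | inj₁ (i , x∈U) = inj₁ (suc i , x∈U)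
  ...   | inj₂ x∈Z = inj₂ x∈Z

  -- By `split`, the colours used on the `U i` and on `Z` can be counted separately, so each `U i`
  -- is replaced by `W i` within its own share. The sets `W i` may be linked to each other, since
  -- their shares stay separate.
  Col-upgrade : ∀ {c} (U W : Fin c → Subset n) Z →
    (∀ i m → Col m (U i) → Col m (W i)) →
    (∀ i j → i ≢ j → NoCross (U i) (U j)) → (∀ i → NoCross (U i) Z) →
    ∀ m → Col m (join U Z) → Col m (join W Z)
  Col-upgrade {zero}  U W Z up ncU ncZ m col = col
  Col-upgrade {suc c} U W Z up ncU ncZ m col
    with split m (U zero) (join (U ∘ suc) Z) nc col
    where
    nc : NoCross (U zero) (join (U ∘ suc) Z)
    nc u∈ v∈ with ∈-join⁻ (U ∘ suc) Z v∈
    ... | inj₁ (i , v∈U) = ncU zero (suc i) (λ ()) u∈ v∈U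
    ... | inj₂ v∈Z = ncZ zero u∈ v∈Z
  ... | a , b , refl , col₀ , col₁ = Col-∪ a b (up zero a col₀)
        (Col-upgrade (U ∘ suc) (W ∘ suc) Z (up ∘ suc)
          (λ i j i≢j → ncU (suc i) (suc j) (λ { refl → i≢j refl })) (ncZ ∘ suc) b col₁)

  -- X is vertex-critical with chromatic number suc κ.
  Crit : ℕ → Subset n → Set
  Crit κ X = ¬ Col κ X × (∀ {x} → x ∈ X → Col κ (X - x))

  Crit⇒Nonempty : ∀ {κ X} → Crit κ X → Nonempty X
  Crit⇒Nonempty {κ} {X} (¬col , _) = decidable-stable (nonempty? X) (λ ¬ne → ¬col (Col-empty κ ¬ne))

  Col-insert : ∀ m {X Y} P → F P → Col m X → Y ─ P ⊆ X → Col (suc m) Y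
  Col-insert m P FP col sub = P , FP , Col-⊆ m sub col

  Crit⇒Col : ∀ {κ X} → Crit κ X → Col (suc κ) X
  Crit⇒Col {κ} {X} crit@(_ , colx) with Crit⇒Nonempty crit
  ... | x , x∈X = Col-insert κ ⁅ x ⁆ (F-⁅⁆ x) (colx x∈X) id

  criticalSubset : ∀ b κ X → ∣ X ∣ ≤ b → ¬ Col κ X → ∃ λ U → U ⊆ X × Crit κ U
  criticalSubset b κ X X≤b ¬col with any? (λ x → (x ∈? X) ×-dec ¬? (Col? κ (X - x)))
  ... | no ¬∃ = X , id , ¬col , λ {x} x∈X → decidable-stable (Col? κ (X - x)) (λ ¬c → ¬∃ (x , x∈X , ¬c))
  criticalSubset zero κ X X≤b ¬col | yes (x , x∈X , _) = contradiction (≤-trans (x∈p⇒1≤∣p∣ X x∈X) X≤b) (λ ())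
  criticalSubset (suc b) κ X X≤b ¬col | yes (x , x∈X , ¬c)
    with criticalSubset b κ (X - x) (s≤s⁻¹ (≤-trans (x∈p⇒∣p-x∣<∣p∣ x∈X) X≤b)) ¬c
  ... | U , U⊆ , crit = U , p─q⊆p X ⁅ x ⁆ ∘ U⊆ , crit

  exact : ∀ m S → Nonempty S → Col m S → ∃ λ κ → ¬ Col κ S × Col (suc κ) S
  exact zero    S ne ¬ne = contradiction ne ¬ne
  exact (suc m) S ne col with Col? m S
  ... | yes col′ = exact m S ne col′
  ... | no ¬col′ = m , ¬col′ , col

  -- A colouring of `X - x` with `κ` colours splits into `a` colours on `S - x` and `b` on `X ─ S`.
  -- If `a` exceeded `κ′`, the `suc κ′` colours that suffice for `S` could replace those `a`, and
  -- `κ` colours would do for `X`.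
  closed⇒Crit : ∀ {κ X} S → Crit κ X → S ⊆ X → Nonempty S → NoCross S (X ─ S) → ∃ λ κ′ → Crit κ′ S
  closed⇒Crit {κ} {X} S crit S⊆X ne nc with exact (suc κ) S ne (Col-⊆ (suc κ) S⊆X (Crit⇒Col crit))
  ... | κ′ , ¬col , col = κ′ , ¬col , colx
    where
    colx : ∀ {x} → x ∈ S → Col κ′ (S - x)
    colx {x} x∈S with split κ (S - x) (X ─ S) (NoCross-⊆ (p─q⊆p S ⁅ x ⁆) id nc)
                        (Col-⊆ κ sub (proj₂ crit (S⊆X x∈S)))
      where
      sub : (S - x) ∪ (X ─ S) ⊆ X - x
      sub y∈ with x∈p∪q⁻ (S - x) (X ─ S) y∈
      ... | inj₁ y∈S = x∈p∧x≢y⇒x∈p-y (S⊆X (p─q⊆p S ⁅ x ⁆ y∈S)) (x∈p-y⇒x≢y S y∈S)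
      ... | inj₂ y∉S = x∈p∧x≢y⇒x∈p-y (p─q⊆p X S y∉S) (λ { refl → x∈p─q⇒x∉q X S y∉S x∈S })
    ... | a , b , a+b≡κ , colS , colR with a ≤? κ′
    ...   | yes a≤κ′ = Col-≤ a≤κ′ colS
    ...   | no  a≰κ′ = contradiction
              (Col-≤ (≤-trans (+-monoˡ-≤ b (≰⇒> a≰κ′)) (≤-reflexive a+b≡κ)) (Col-⊆ (suc κ′ + b) sub (Col-∪ (suc κ′) b col colR)))
              (proj₁ crit)
      where
      sub : X ⊆ S ∪ (X ─ S)
      sub {y} y∈X with y ∈? S
      ... | yes y∈S = p⊆p∪q _ y∈S
      ... | no  y∉S = q⊆p∪q S _ (x∈p∧x∉q⇒x∈p─q y∈X y∉S)

  -- Decomposition into unlinked critical parts.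

  Cut : Subset n → Subset n → Set
  Cut X K = K ⊆ X × Nonempty K × Nonempty (X ─ K) × NoCross K (X ─ K)

  Cut? : ∀ X K → Dec (Cut X K)
  Cut? X K = (K ⊆? X) ×-dec nonempty? K ×-dec nonempty? (X ─ K) ×-dec NoCross? K (X ─ K)

  -- Connectedness of the graph of linked pairs on `X`.
  Indecomposable : Subset n → Set
  Indecomposable X = ¬ ∃ (Cut X)

  component : ∀ b X → ∣ X ∣ ≤ b → Nonempty X → ∃ λ K → K ⊆ X × Nonempty K × NoCross K (X ─ K) × Indecomposable K
  component b X X≤b ne with anySubset? (Cut? X)
  ... | no ¬cut = X , id , ne , (λ _ v∈ → contradiction (p─q⊆p X X v∈) (x∈p─q⇒x∉q X X v∈)) , ¬cut
  component zero X X≤b (x , x∈X) | yes _ = contradiction (≤-trans (x∈p⇒1≤∣p∣ X x∈X) X≤b) (λ ())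
  component (suc b) X X≤b ne | yes (K , K⊆X , neK , (y , y∈) , nc)
    with component b K (s≤s⁻¹ (≤-trans (p⊂q⇒∣p∣<∣q∣ (K⊆X , y , p─q⊆p X K y∈ , x∈p─q⇒x∉q X K y∈)) X≤b)) neK
  ... | D , D⊆K , neD , ncD , indec = D , K⊆X ∘ D⊆K , neD , ncDX , indec
    where
    ncDX : NoCross D (X ─ D)
    ncDX {u} {v} u∈ v∈ with v ∈? K
    ... | yes v∈K = ncD u∈ (x∈p∧x∉q⇒x∈p─q v∈K (x∈p─q⇒x∉q X D v∈))
    ... | no  v∉K = nc (D⊆K u∈) (x∈p∧x∉q⇒x∈p─q (p─q⊆p X D v∈) v∉K)

  -- Part `i` has chromatic number `suc (κ i)`, so `large` reads |part| ≥ 2χ - 1.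
  record Decomposition (X : Subset n) : Set where
    field
      parts  : ℕ
      part   : Fin parts → Subset n
      κ      : Fin parts → ℕ
      crit   : ∀ i → Crit (κ i) (part i)
      large  : ∀ i → κ i + suc (κ i) ≤ ∣ part i ∣
      part⊆  : ∀ i → part i ⊆ X
      apart  : ∀ i j → i ≢ j → NoCross (part i) (part j)
      cover  : ∀ {x} → x ∈ X → ∃ λ i → x ∈ part i
      sizes  : ΣFin (λ i → ∣ part i ∣) ≤ ∣ X ∣
      colour : Col (ΣFin (suc ∘ κ)) X

  -- The induction hypothesis as a type, so that `decompose` can be called inside the induction that
  -- proves it.
  LargeUpTo : ℕ → Set
  LargeUpTo b = ∀ κ X → ∣ X ∣ ≤ b → Crit κ X → Indecomposable X → κ + suc κ ≤ ∣ X ∣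

  cons-decomposition : ∀ X K κ → K ⊆ X → NoCross K (X ─ K) → Crit κ K → κ + suc κ ≤ ∣ K ∣ →
                       Decomposition (X ─ K) → Decomposition X
  cons-decomposition X K κ K⊆X nc crit large D = record
    { parts = suc D.parts
    ; part = part
    ; κ = λ { zero → κ ; (suc i) → D.κ i }
    ; crit = λ { zero → crit ; (suc i) → D.crit i }
    ; large = λ { zero → large ; (suc i) → D.large i }
    ; part⊆ = λ { zero → K⊆X ; (suc i) → p─q⊆p X K ∘ D.part⊆ i }
    ; apart = apart
    ; cover = cover
    ; sizes = ≤-trans (+-monoʳ-≤ ∣ K ∣ D.sizes) (q⊆p⇒∣q∣+∣p─q∣≤∣p∣ X K K⊆X)
    ; colour = Col-⊆ (suc κ + ΣFin (suc ∘ D.κ)) sub (Col-∪ (suc κ) _ (Crit⇒Col crit) D.colour) }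
    where
    module D = Decomposition D
    part : Fin (suc D.parts) → Subset n
    part zero    = K
    part (suc i) = D.part i
    apart : ∀ i j → i ≢ j → NoCross (part i) (part j)
    apart zero    zero    i≢j = contradiction refl i≢j
    apart zero    (suc j) i≢j = NoCross-⊆ id (D.part⊆ j) nc
    apart (suc i) zero    i≢j u∈ v∈ l = nc v∈ (D.part⊆ i u∈) (Linked-sym l)
    apart (suc i) (suc j) i≢j = D.apart i j (i≢j ∘ cong suc)
    cover : ∀ {x} → x ∈ X → ∃ λ i → x ∈ part i
    cover {x} x∈X with x ∈? K
    ... | yes x∈K = zero , x∈K
    ... | no  x∉K with D.cover (x∈p∧x∉q⇒x∈p─q x∈X x∉K)
    ...   | i , x∈i = suc i , x∈i
    sub : X ⊆ K ∪ (X ─ K)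
    sub {x} x∈X with x ∈? K
    ... | yes x∈K = p⊆p∪q _ x∈K
    ... | no  x∉K = q⊆p∪q K _ (x∈p∧x∉q⇒x∈p─q x∈X x∉K)

  -- A component `K` is split off and the rest is treated recursively; `closed⇒Crit` keeps both
  -- critical. Criticality is asked of non-empty `X` only, because the rest may be empty and no
  -- critical set is. `d` bounds the recursion, `b` the range of the hypothesis `L`.
  decompose : ∀ {b} → LargeUpTo b → ∀ d X → ∣ X ∣ ≤ d → ∣ X ∣ ≤ b →
              (Nonempty X → ∃ λ κ → Crit κ X) → Decomposition X
  decompose L d X X≤d X≤b crit with nonempty? X
  ... | no ¬ne = record
    { parts = 0 ; part = λ () ; κ = λ () ; crit = λ () ; large = λ () ; part⊆ = λ () ; apart = λ ()
    ; cover = λ x∈ → contradiction (_ , x∈) ¬ne ; sizes = z≤n ; colour = ¬ne }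
  decompose L zero X X≤d X≤b crit | yes (x , x∈X) = contradiction (≤-trans (x∈p⇒1≤∣p∣ X x∈X) X≤d) (λ ())
  decompose L (suc d) X X≤d X≤b crit | yes ne
    with crit ne | component (suc d) X X≤d ne
  ... | κ , critX | K , K⊆X , neK@(y , y∈K) , nc , indec with closed⇒Crit K critX K⊆X neK nc
  ...   | κ′ , critK = cons-decomposition X K κ′ K⊆X nc critK
            (L κ′ K (≤-trans (p⊆q⇒∣p∣≤∣q∣ K⊆X) X≤b) critK indec)
            (decompose L d (X ─ K)
              (s≤s⁻¹ (≤-trans (p∩q≢∅⇒∣p─q∣<∣p∣ X K (y , x∈p∩q⁺ (K⊆X y∈K , y∈K))) X≤d))
              (≤-trans (∣p─q∣≤∣p∣ X K) X≤b)
              (λ neR → closed⇒Crit (X ─ K) critX (p─q⊆p X K) neR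
                (λ {u} {v} u∈ v∈ l → nc (back v∈) u∈ (Linked-sym l))))
    where
    back : X ─ (X ─ K) ⊆ K
    back {v} v∈ = decidable-stable (v ∈? K)
      (λ v∉K → x∈p─q⇒x∉q X (X ─ K) v∈ (x∈p∧x∉q⇒x∈p─q (p─q⊆p X (X ─ K) v∈) v∉K))

  -- Absorbing outer vertices into critical parts.

  module _ {κ : ℕ} {X U : Subset n} (critX : Crit κ X) (U⊆X : U ⊆ X) (D : Decomposition U) where

    private module D = Decomposition D

    Attached : Fin n → Fin D.parts → Set
    Attached r i = ∃ λ u → u ∈ D.part i × Linked u r

    Attached? : ∀ r i → Dec (Attached r i)
    Attached? r i = any? (λ u → (u ∈? D.part i) ×-dec F? (⁅ u ⁆ ∪ ⁅ r ⁆))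

    open Matching Attached Attached?

    -- A critical part takes more than `κ i` colours, so `m` is at least `suc (κ i)`. Without `u`
    -- the part takes only `κ i`, and the linked pair of `u` and `r` serves as the additional class.
    attach : ∀ {r i} → Attached r i → ∀ m → Col m (D.part i) → Col m (D.part i ∪ ⁅ r ⁆)
    attach {r} {i} (u , u∈ , l) m col with m ≤? D.κ i
    ... | yes m≤κ = contradiction (Col-≤ m≤κ col) (proj₁ (D.crit i))
    ... | no  m≰κ = Col-≤ (≰⇒> m≰κ) (Col-insert (D.κ i) (⁅ u ⁆ ∪ ⁅ r ⁆) l (proj₂ (D.crit i) u∈) sub)
      where
      sub : D.part i ∪ ⁅ r ⁆ ─ ⁅ u ⁆ ∪ ⁅ r ⁆ ⊆ D.part i - u
      sub {x} x∈ with x∈p∪q⁻ (D.part i) ⁅ r ⁆ (p─q⊆p (D.part i ∪ ⁅ r ⁆) (⁅ u ⁆ ∪ ⁅ r ⁆) x∈)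
      ... | inj₁ x∈p = x∈p∧x∉q⇒x∈p─q x∈p (λ x∈u → x∈p─q⇒x∉q (D.part i ∪ ⁅ r ⁆) (⁅ u ⁆ ∪ ⁅ r ⁆) x∈ (p⊆p∪q ⁅ r ⁆ x∈u))
      ... | inj₂ x∈r = contradiction (q⊆p∪q ⁅ u ⁆ ⁅ r ⁆ x∈r) (x∈p─q⇒x∉q (D.part i ∪ ⁅ r ⁆) (⁅ u ⁆ ∪ ⁅ r ⁆) x∈)

    -- Every matched vertex is absorbed by its part without a new colour, and X ─ A has κ colours.
    ¬EnvyFree : ∀ {Y} → ¬ EnvyFree (X ─ U) Y
    ¬EnvyFree ef = proj₁ critX (Col-⊆ κ X⊆ (Col-upgrade before after Z up ncP ncZ κ (Col-⊆ κ ⊆X-a (proj₂ critX (A⊆X′ a∈A)))))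
      where
      open EnvyFree ef
      open Match match
      a = proj₁ nonempty
      a∈A = proj₂ nonempty
      A⊆X′ : A ⊆ X
      A⊆X′ = p─q⊆p X U ∘ A⊆X
      A∉U : ∀ {r} → r ∈ A → r ∉ U
      A∉U = x∈p─q⇒x∉q X U ∘ A⊆X
      -- Both families are indexed by all of `Fin n` and empty outside `A`, so that `join` applies
      -- without enumerating `A`.
      before after : Fin n → Subset n
      before r with r ∈? A
      ... | yes _ = D.part (to r)
      ... | no  _ = ⊥
      after r with r ∈? A
      ... | yes _ = D.part (to r) ∪ ⁅ r ⁆
      ... | no  _ = ⊥
      before⁺ : ∀ {r} → r ∈ A → D.part (to r) ⊆ before r
      before⁺ {r} r∈A x∈ with r ∈? A
      ... | yes _   = x∈
      ... | no  r∉A = contradiction r∈A r∉A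
      before⁻ : ∀ {r x} → x ∈ before r → r ∈ A × x ∈ D.part (to r)
      before⁻ {r} x∈ with r ∈? A
      ... | yes r∈A = r∈A , x∈
      ... | no  _   = contradiction x∈ ∉⊥
      after⁺ : ∀ {r} → r ∈ A → D.part (to r) ∪ ⁅ r ⁆ ⊆ after r
      after⁺ {r} r∈A x∈ with r ∈? A
      ... | yes _   = x∈
      ... | no  r∉A = contradiction r∈A r∉A
      Z = X ─ A ─ join before ⊥
      Z⊆X─A : Z ⊆ X ─ A
      Z⊆X─A = p─q⊆p (X ─ A) (join before ⊥)
      up : ∀ r m → Col m (before r) → Col m (after r)
      up r m col with r ∈? A
      ... | yes r∈A = attach (to-E r∈A) m col
      ... | no  _   = col
      ncP : ∀ r s → r ≢ s → NoCross (before r) (before s)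
      ncP r s r≢s u∈ v∈ with before⁻ {r} u∈ | before⁻ {s} v∈
      ... | r∈A , u∈r | s∈A , v∈s = D.apart (to r) (to s) (r≢s ∘ to-inj r∈A s∈A) u∈r v∈s
      -- A vertex of `Z` outside `U` is kept apart by `closed`, one inside `U` by lying in another
      -- part.
      ncZ : ∀ r → NoCross (before r) Z
      ncZ r {u} {v} u∈ v∈ l with before⁻ {r} u∈ | v ∈? U
      ... | r∈A , u∈r | no v∉U = x∈p─q⇒x∉q X A (Z⊆X─A v∈)
              (closed r∈A (x∈p∧x∉q⇒x∈p─q (p─q⊆p X A (Z⊆X─A v∈)) v∉U) (u , u∈r , l))
      ... | r∈A , u∈r | yes v∈U with D.cover v∈U
      ...   | i , v∈i with to r ≟ i
      ...     | no  tor≢i = D.apart (to r) i tor≢i u∈r v∈i l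
      ...     | yes refl  = x∈p─q⇒x∉q (X ─ A) (join before ⊥) v∈ (∈-join⁺ˡ before ⊥ r (before⁺ r∈A v∈i))
      ⊆X-a : join before Z ⊆ X - a
      ⊆X-a x∈ with ∈-join⁻ before Z x∈
      ... | inj₁ (r , x∈r) with before⁻ {r} x∈r
      ...   | r∈A , x∈p = x∈p∧x≢y⇒x∈p-y (U⊆X (D.part⊆ (to r) x∈p)) (λ { refl → A∉U a∈A (D.part⊆ (to r) x∈p) })
      ⊆X-a x∈ | inj₂ x∈Z = x∈p∧x≢y⇒x∈p-y (p─q⊆p X A (Z⊆X─A x∈Z)) (λ { refl → x∈p─q⇒x∉q X A (Z⊆X─A x∈Z) a∈A })
      X⊆ : X ⊆ join after Z
      X⊆ {x} x∈X with x ∈? A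
      ... | yes x∈A = ∈-join⁺ˡ after Z x (after⁺ x∈A (q⊆p∪q (D.part (to x)) ⁅ x ⁆ (x∈⁅x⁆ x)))
      ... | no  x∉A with x ∈? join before ⊥
      ...   | no  x∉J = ∈-join⁺ʳ after Z (x∈p∧x∉q⇒x∈p─q (x∈p∧x∉q⇒x∈p─q x∈X x∉A) x∉J)
      ...   | yes x∈J with ∈-join⁻ before ⊥ x∈J
      ...     | inj₂ x∈⊥ = contradiction x∈⊥ ∉⊥
      ...     | inj₁ (r , x∈r) with before⁻ {r} x∈r
      ...       | r∈A , x∈p = ∈-join⁺ˡ after Z r (after⁺ r∈A (p⊆p∪q ⁅ r ⁆ x∈p))

    -- A part is unlinked to the other parts. Without a link to `X ─ U` it would therefore be one
    -- side of a cut of `X`, with `v` on the other side.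
    attached : Indecomposable X → ∀ {v} → v ∈ X ─ U → ∀ i → ∃ λ r → r ∈ X ─ U × Attached r i
    attached indec {v} v∈ i = decidable-stable (any? (λ r → (r ∈? (X ─ U)) ×-dec Attached? r i)) λ ¬∃ →
      indec (D.part i , U⊆X ∘ D.part⊆ i , Crit⇒Nonempty (D.crit i) ,
             (v , x∈p∧x∉q⇒x∈p─q (p─q⊆p X U v∈) (x∈p─q⇒x∉q X U v∈ ∘ D.part⊆ i)) ,
             λ {u} {w} u∈ w∈ l → case w ∈? U of λ where
               (no w∉U)  → ¬∃ (w , x∈p∧x∉q⇒x∈p─q (p─q⊆p X (D.part i) w∈) w∉U , u , u∈ , l)
               (yes w∈U) → case D.cover w∈U of λ (j , w∈j) →
                 D.apart i j (λ { refl → x∈p─q⇒x∉q X (D.part i) w∈ w∈j }) u∈ w∈j l)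

    parts<∣X─U∣ : Indecomposable X → Nonempty (X ─ U) → D.parts < ∣ X ─ U ∣
    parts<∣X─U∣ indec (v , v∈) = ≰⇒> λ R≤c →
      ¬EnvyFree (envyFree _ (X ─ U) ⊤ ≤-refl (v , v∈) (≤-trans R≤c (≤-reflexive (≡-sym (∣⊤∣≡n D.parts))))
        (λ {i} _ → attached indec v∈ i))

  -- The bound |X| ≥ 2χ - 1 for indecomposable critical sets.

  -- Each part satisfies 2χ ≤ |part| + 1, and the ones add up to `parts`.
  doubled : ∀ {X} (D : Decomposition X) (let open Decomposition D) →
            ΣFin (suc ∘ κ) + ΣFin (suc ∘ κ) ≤ ∣ X ∣ + parts
  doubled {X} D = begin
    ΣFin (suc ∘ κ) + ΣFin (suc ∘ κ)             ≡⟨ ΣFin-+ (suc ∘ κ) (suc ∘ κ) ⟨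
    ΣFin (λ i → suc (κ i) + suc (κ i))          ≤⟨ ΣFin-mono (λ i → ≤-trans (s≤s (large i)) (≤-reflexive (+-comm 1 ∣ part i ∣))) ⟩
    ΣFin (λ i → ∣ part i ∣ + 1)                 ≡⟨ ΣFin-+ (λ i → ∣ part i ∣) (λ _ → 1) ⟩
    ΣFin (λ i → ∣ part i ∣) + ΣFin {parts} (λ _ → 1)    ≤⟨ +-mono-≤ sizes (≤-reflexive (trans (ΣFin-const parts 1) (*-identityʳ parts))) ⟩
    ∣ X ∣ + parts                               ∎
    where
    open Decomposition D
    open ≤-Reasoning

  ¬Col⇒≤colours : ∀ {κ X} (D : Decomposition X) → ¬ Col κ X → suc κ ≤ ΣFin (suc ∘ Decomposition.κ D)
  ¬Col⇒≤colours D ¬col = ≰⇒> (λ ≤κ → ¬col (Col-≤ ≤κ (Decomposition.colour D)))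

  largeUpTo : ∀ b → LargeUpTo b
  largeUpTo b κ X X≤b crit indec = decidable-stable (κ + suc κ ≤? ∣ X ∣) (λ ¬large → small b κ X≤b crit (≰⇒> ¬large))
    where
    small : ∀ b κ → ∣ X ∣ ≤ b → Crit κ X → ¬ (∣ X ∣ < κ + suc κ)
    small b κ X≤b crit X< with Crit⇒Nonempty crit
    small zero κ X≤b crit X< | v , v∈X = contradiction (≤-trans (x∈p⇒1≤∣p∣ X v∈X) X≤b) (λ ())
    small (suc b) zero X≤b crit (s≤s X≤0) | v , v∈X = contradiction (≤-trans (x∈p⇒1≤∣p∣ X v∈X) X≤0) (λ ())
    -- The vertex `v` forms a class by itself, so `X - v` still takes more than `κ` colours and
    -- contains a critical `U` of chromatic number one less than `X`. As `U` avoids `v`, it is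
    -- smaller than `X` and `X ─ U` is non-empty.
    small (suc b) (suc κ) X≤b crit X< | v , v∈X
      with criticalSubset _ κ (X - v) ≤-refl
             (λ col → proj₁ crit (Col-insert κ ⁅ v ⁆ (F-⁅⁆ v) col id))
    ... | U , U⊆X-v , critU = <⇒≱ (parts<∣X─U∣ crit U⊆X D indec (v , v∈R)) (+-cancelˡ-≤ ∣ U ∣ _ _ (begin
        ∣ U ∣ + ∣ X ─ U ∣                   ≤⟨ q⊆p⇒∣q∣+∣p─q∣≤∣p∣ X U U⊆X ⟩
        ∣ X ∣                               ≤⟨ s≤s⁻¹ X< ⟩
        κ + suc (suc κ)                     ≡⟨ +-suc κ (suc κ) ⟩
        suc κ + suc κ                       ≤⟨ +-mono-≤ (¬Col⇒≤colours D (proj₁ critU)) (¬Col⇒≤colours D (proj₁ critU)) ⟩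
        ΣFin (suc ∘ D.κ) + ΣFin (suc ∘ D.κ) ≤⟨ doubled D ⟩
        ∣ U ∣ + D.parts                     ∎))
      where
      open ≤-Reasoning
      U⊆X : U ⊆ X
      U⊆X = p─q⊆p X ⁅ v ⁆ ∘ U⊆X-v
      v∉U : v ∉ U
      v∉U v∈U = x∈p-y⇒x≢y X (U⊆X-v v∈U) refl
      v∈R : v ∈ X ─ U
      v∈R = x∈p∧x∉q⇒x∈p─q v∈X v∉U
      U≤b : ∣ U ∣ ≤ b
      U≤b = s≤s⁻¹ (≤-trans (p⊂q⇒∣p∣<∣q∣ (U⊆X , v , v∈X , v∉U)) X≤b)
      D : Decomposition U
      D = decompose (largeUpTo b) b U U≤b U≤b (λ _ → κ , critU)
      module D = Decomposition D

  decomposition : ∀ {κ X} → Crit κ X → Decomposition X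
  decomposition {κ} {X} crit = decompose (largeUpTo ∣ X ∣) _ X ≤-refl ≤-refl (λ _ → κ , crit)

-- Double sums and sums over subsets.

ΣFin-swap : ∀ {m n} (f : Fin m → Fin n → ℕ) → ΣFin (λ i → ΣFin (f i)) ≡ ΣFin (λ j → ΣFin (λ i → f i j))
ΣFin-swap {zero}  {n} f = ≡-sym (trans (ΣFin-const n 0) (*-zeroʳ n))
ΣFin-swap {suc m} {n} f = trans (cong (ΣFin (f zero) +_) (ΣFin-swap (f ∘ suc)))
                                (≡-sym (ΣFin-+ (f zero) (λ j → ΣFin (λ i → f (suc i) j))))

ΣFin-*ˡ : ∀ {n} a (f : Fin n → ℕ) → ΣFin (λ i → a * f i) ≡ a * ΣFin f
ΣFin-*ˡ {zero}  a f = ≡-sym (*-zeroʳ a)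
ΣFin-*ˡ {suc n} a f = trans (cong (a * f zero +_) (ΣFin-*ˡ a (f ∘ suc))) (≡-sym (*-distribˡ-+ a (f zero) _))

term≤ΣFin : ∀ {n} (f : Fin n → ℕ) i → f i ≤ ΣFin f
term≤ΣFin f zero    = m≤m+n _ _
term≤ΣFin f (suc i) = ≤-trans (term≤ΣFin (f ∘ suc) i) (m≤n+m _ _)

positive-term+n≤ΣFin : ∀ {n} (f : Fin n → ℕ) → (∀ i → 1 ≤ f i) → ∀ i → f i + n ≤ suc (ΣFin f)
positive-term+n≤ΣFin {suc n} f pos zero = begin
  f zero + suc n          ≡⟨ +-suc (f zero) n ⟩
  suc (f zero + n)        ≡⟨ cong (λ m → suc (f zero + m)) (trans (ΣFin-const n 1) (*-identityʳ n)) ⟨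
  suc (f zero + ΣFin {n} (λ _ → 1)) ≤⟨ s≤s (+-monoʳ-≤ (f zero) (ΣFin-mono (pos ∘ suc))) ⟩
  suc (ΣFin f)            ∎
  where open ≤-Reasoning
positive-term+n≤ΣFin {suc n} f pos (suc i) = begin
  f (suc i) + suc n       ≡⟨ +-suc (f (suc i)) n ⟩
  suc (f (suc i) + n)     ≤⟨ +-mono-≤ (pos zero) (positive-term+n≤ΣFin (f ∘ suc) (pos ∘ suc) i) ⟩
  f zero + suc (ΣFin (f ∘ suc)) ≡⟨ +-suc (f zero) _ ⟩
  suc (ΣFin f)            ∎
  where open ≤-Reasoning

restrict : ∀ {n} → Subset n → (Fin n → ℕ) → Fin n → ℕ
restrict T f u = if lookup T u then f u else 0

restrict-∈ : ∀ {n} {u : Fin n} {T} (f : Fin n → ℕ) → u ∈ T → restrict T f u ≡ f u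
restrict-∈ f u∈T rewrite []=⇒lookup u∈T = refl

restrict-∉ : ∀ {n} {u : Fin n} {T} (f : Fin n → ℕ) → u ∉ T → restrict T f u ≡ 0
restrict-∉ {u = u} {T} f u∉T with lookup T u in eq
... | true  = contradiction (lookup⇒[]= u T eq) u∉T
... | false = refl

sumOn : ∀ {n} → Subset n → (Fin n → ℕ) → ℕ
sumOn T f = ΣFin (restrict T f)

restrict-mono : ∀ {n} {T T′ : Subset n} {f g : Fin n → ℕ} →
                (∀ {u} → u ∈ T → f u ≡ 0 ⊎ u ∈ T′ × f u ≤ g u) → ∀ u → restrict T f u ≤ restrict T′ g u
restrict-mono {T = T} {T′} {f} {g} h u with u ∈? T
... | no  u∉T = ≤-trans (≤-reflexive (restrict-∉ f u∉T)) z≤n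
... | yes u∈T rewrite restrict-∈ f u∈T with h u∈T
...   | inj₁ fu≡0 = ≤-trans (≤-reflexive fu≡0) z≤n
...   | inj₂ (u∈T′ , fu≤gu) = ≤-trans fu≤gu (≤-reflexive (≡-sym (restrict-∈ g u∈T′)))

sumOn-mono : ∀ {n} {T T′ : Subset n} {f g : Fin n → ℕ} →
             (∀ {u} → u ∈ T → f u ≡ 0 ⊎ u ∈ T′ × f u ≤ g u) → sumOn T f ≤ sumOn T′ g
sumOn-mono h = ΣFin-mono (restrict-mono h)

sumOn-const : ∀ {n} (T : Subset n) a → sumOn T (λ _ → a) ≡ ∣ T ∣ * a
sumOn-const []            a = refl
sumOn-const (inside  ∷ T) a = cong (a +_) (sumOn-const T a)
sumOn-const (outside ∷ T) a = sumOn-const T a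

sumOn-⊥ : ∀ {n} (f : Fin n → ℕ) → sumOn ⊥ f ≡ 0
sumOn-⊥ {n} f = trans (ΣFin-cong (λ u → restrict-∉ f (∉⊥ {x = u}))) (trans (ΣFin-const n 0) (*-zeroʳ n))

sumOn-⁅⁆ : ∀ {n} (v : Fin n) f → sumOn ⁅ v ⁆ f ≡ f v
sumOn-⁅⁆ zero    f = trans (cong (f zero +_) (sumOn-⊥ (f ∘ suc))) (+-identityʳ _)
sumOn-⁅⁆ (suc v) f = sumOn-⁅⁆ v (f ∘ suc)

disjoint⇒sumOn-+ : ∀ {n} (S T X : Subset n) f → S ⊆ X → T ⊆ X → (∀ {x} → x ∈ S → x ∉ T) →
                   sumOn S f + sumOn T f ≤ sumOn X f
disjoint⇒sumOn-+ S T X f S⊆X T⊆X dis = ≤-trans (≤-reflexive (≡-sym (ΣFin-+ (restrict S f) (restrict T f)))) (ΣFin-mono pointwise)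
  where
  pointwise : ∀ u → restrict S f u + restrict T f u ≤ restrict X f u
  pointwise u with u ∈? S
  ... | no  u∉S rewrite restrict-∉ f u∉S = restrict-mono {f = f} {f} (λ u∈T → inj₂ (T⊆X u∈T , ≤-refl)) u
  ... | yes u∈S rewrite restrict-∉ f (dis u∈S) | +-identityʳ (restrict S f u) =
    restrict-mono {f = f} {f} (λ u∈S → inj₂ (S⊆X u∈S , ≤-refl)) u

-- Sparse sets of a weight function.

module Sparsity {n : ℕ} (t : ℕ) (1≤t : 1 ≤ t) where

  -- Strict `t`-degeneracy, tested on vertex subsets only, since fewer edges only lower degrees. A
  -- weight function in place of a graph lets different multiplicities be compared on the same
  -- subsets.
  Sparse : (Fin n → Fin n → ℕ) → Subset n → Set
  Sparse w T = ∀ S → S ⊆ T → Nonempty S → ∃ λ v → v ∈ S × sumOn S (w v) < t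

  module _ (w : Fin n → Fin n → ℕ) (w-irrefl : ∀ v → w v v ≡ 0) where

    low? : ∀ S → Dec (∃ λ v → v ∈ S × sumOn S (w v) < t)
    low? S = any? (λ v → (v ∈? S) ×-dec (sumOn S (w v) <? t))

    sparse? : ∀ T → Dec (Sparse w T)
    sparse? T with anySubset? (λ S → (S ⊆? T) ×-dec nonempty? S ×-dec ¬? (low? S))
    ... | yes (S , S⊆T , ne , ¬low) = no (λ sp → ¬low (sp S S⊆T ne))
    ... | no ¬∃ = yes (λ S S⊆T ne → decidable-stable (low? S) (λ ¬low → ¬∃ (S , (λ x∈ → S⊆T x∈) , ne , ¬low)))

    sparse-⊆ : ∀ S T → S ⊆ T → Sparse w T → Sparse w S
    sparse-⊆ S T S⊆T sp R R⊆S = sp R (S⊆T ∘ R⊆S)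

    sparse-⊥ : Sparse w ⊥
    sparse-⊥ S S⊆⊥ (x , x∈S) = contradiction (S⊆⊥ x∈S) ∉⊥

    -- A subset avoiding `v` lies in `T`; in one containing `v`, the vertex `v` itself has low
    -- degree.
    sparse-insert : ∀ T v → Sparse w T → sumOn T (w v) < t → Sparse w (T ∪ ⁅ v ⁆)
    sparse-insert T v sp lt S S⊆ ne with v ∈? S
    ... | no  v∉S = sp S (λ x∈S → x∈p∪⁅y⁆∧x≢y⇒x∈p T (S⊆ x∈S) (λ { refl → v∉S x∈S })) ne
    ... | yes v∈S = v , v∈S , ≤-<-trans (sumOn-mono sub) lt
      where
      sub : ∀ {u} → u ∈ S → w v u ≡ 0 ⊎ u ∈ T × w v u ≤ w v u
      sub {u} u∈S with u ≟ v
      ... | yes refl = inj₁ (w-irrefl v)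
      ... | no  u≢v  = inj₂ (x∈p∪⁅y⁆∧x≢y⇒x∈p T (S⊆ u∈S) u≢v , ≤-refl)

    sparse-⁅⁆ : ∀ v → Sparse w ⁅ v ⁆
    sparse-⁅⁆ v = sparse-⊆ _ (⊥ ∪ ⁅ v ⁆) (q⊆p∪q ⊥ ⁅ v ⁆)
      (sparse-insert ⊥ v sparse-⊥ (≤-trans (s≤s (≤-reflexive (sumOn-⊥ (w v)))) 1≤t))

  module Weighted (w : Fin n → Fin n → ℕ) (w-irrefl : ∀ v → w v v ≡ 0) where

    open Hereditary (Sparse w) (sparse? w w-irrefl) (sparse-⊆ w w-irrefl) (sparse-⊥ w w-irrefl) (sparse-⁅⁆ w w-irrefl) public

    -- `v` sends weight at least `t` to each of the `m` classes, as it could otherwise join that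
    -- class without a new colour. The pieces `X ∩ P` and `X ─ P` are disjoint, so the contributions
    -- add up.
    ¬Col-insert⇒m*t≤ : ∀ m X v → Col m X → ¬ Col m (X ∪ ⁅ v ⁆) → m * t ≤ sumOn X (w v)
    ¬Col-insert⇒m*t≤ zero    X v col ¬col = z≤n
    ¬Col-insert⇒m*t≤ (suc m) X v (P , FP , col) ¬col = ≤-trans
      (+-mono-≤ (≮⇒≥ (λ lt → ¬col (Col-insert m _ (sparse-insert w w-irrefl (X ∩ P) v (sparse-⊆ w w-irrefl (X ∩ P) P (p∩q⊆q X P) FP) lt) col sub₁)))
                (¬Col-insert⇒m*t≤ m (X ─ P) v col (λ col′ → ¬col (Col-insert m P FP col′ sub₂))))
      (disjoint⇒sumOn-+ (X ∩ P) (X ─ P) X (w v) (p∩q⊆p X P) (p─q⊆p X P)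
        (λ x∈ x∈X─P → x∈p─q⇒x∉q X P x∈X─P (p∩q⊆q X P x∈)))
      where
      sub₁ : X ∪ ⁅ v ⁆ ─ (X ∩ P) ∪ ⁅ v ⁆ ⊆ X ─ P
      sub₁ {x} x∈ = x∈p∧x∉q⇒x∈p─q x∈X (λ x∈P → x∉ (p⊆p∪q ⁅ v ⁆ (x∈p∩q⁺ (x∈X , x∈P))))
        where
        x∉ = x∈p─q⇒x∉q (X ∪ ⁅ v ⁆) (X ∩ P ∪ ⁅ v ⁆) x∈
        x∈X : x ∈ X
        x∈X = x∈p∪⁅y⁆∧x≢y⇒x∈p X (p─q⊆p (X ∪ ⁅ v ⁆) (X ∩ P ∪ ⁅ v ⁆) x∈) (λ { refl → x∉ (q⊆p∪q (X ∩ P) ⁅ v ⁆ (x∈⁅x⁆ v)) })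
      sub₂ : X ∪ ⁅ v ⁆ ─ P ⊆ (X ─ P) ∪ ⁅ v ⁆
      sub₂ {x} x∈ with x∈p∪q⁻ X ⁅ v ⁆ (p─q⊆p (X ∪ ⁅ v ⁆) P x∈)
      ... | inj₁ x∈X = p⊆p∪q ⁅ v ⁆ (x∈p∧x∉q⇒x∈p─q x∈X (x∈p─q⇒x∉q (X ∪ ⁅ v ⁆) P x∈))
      ... | inj₂ x∈v = q⊆p∪q (X ─ P) ⁅ v ⁆ x∈v

    Crit⇒κ*t≤ : ∀ {κ X v} → Crit κ X → v ∈ X → κ * t ≤ sumOn (X - v) (w v)
    Crit⇒κ*t≤ {κ} {X} {v} (¬col , colx) v∈X = ¬Col-insert⇒m*t≤ κ (X - v) v (colx v∈X) (¬col ∘ Col-⊆ κ sub)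
      where
      sub : X ⊆ (X - v) ∪ ⁅ v ⁆
      sub {x} x∈X with x ≟ v
      ... | yes refl = q⊆p∪q (X - v) ⁅ v ⁆ (x∈⁅x⁆ v)
      ... | no  x≢v  = p⊆p∪q ⁅ v ⁆ (x∈p∧x≢y⇒x∈p-y x∈X x≢v)

    ¬Linked⇒t≤ : ∀ {u v} → ¬ Linked u v → t ≤ w v u
    ¬Linked⇒t≤ {u} {v} ¬l = ≮⇒≥ (λ lt → ¬l (sparse-insert w w-irrefl ⁅ u ⁆ v (sparse-⁅⁆ w w-irrefl u)
      (≤-trans (s≤s (≤-reflexive (sumOn-⁅⁆ u (w v)))) lt)))

    -- Colour functions in the style of `Colorable`. Sparseness is stated for every `T` inside a
    -- class, which avoids building the class as a `Subset`.
    Classes : Subset n → ℕ → Set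
    Classes X m = Σ (Fin n → ℕ) λ c → (∀ {v} → v ∈ X → c v < m) ×
                  (∀ i T → (∀ {v} → v ∈ T → v ∈ X × c v ≡ i) → Sparse w T)

    -- The class `P` peeled off first receives the largest colour `m`; the rest is coloured below
    -- `m`.
    Col⇒Classes : ∀ m X → Col m X → Classes X m
    Col⇒Classes zero X ¬ne = (λ _ → 0) , (λ v∈ → contradiction (_ , v∈) ¬ne) ,
      λ i T h S S⊆T (x , x∈S) → contradiction (x , proj₁ (h (S⊆T x∈S))) ¬ne
    Col⇒Classes (suc m) X (P , FP , col) with Col⇒Classes m (X ─ P) col
    ... | c′ , c′<m , classes = c , (λ {v} → c< {v}) , classes⁺
      where
      c : Fin n → ℕ
      c v with v ∈? P
      ... | yes _ = m
      ... | no  _ = c′ v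
      c< : ∀ {v} → v ∈ X → c v < suc m
      c< {v} v∈X with v ∈? P
      ... | yes _   = ≤-refl
      ... | no  v∉P = m≤n⇒m≤1+n (c′<m (x∈p∧x∉q⇒x∈p─q v∈X v∉P))
      last : ∀ {v} → v ∈ X → c v ≡ m → v ∈ P
      last {v} v∈X eq with v ∈? P
      ... | yes v∈P = v∈P
      ... | no  v∉P = contradiction eq (<⇒≢ (c′<m (x∈p∧x∉q⇒x∈p─q v∈X v∉P)))
      earlier : ∀ {v} → c v ≢ m → v ∉ P × c v ≡ c′ v
      earlier {v} cv≢m with v ∈? P
      ... | yes _   = contradiction refl cv≢m
      ... | no  v∉P = v∉P , refl
      classes⁺ : ∀ i T → (∀ {v} → v ∈ T → v ∈ X × c v ≡ i) → Sparse w T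
      classes⁺ i T h with i ≟ℕ m
      ... | yes refl = sparse-⊆ w w-irrefl T P (λ v∈T → last (proj₁ (h v∈T)) (proj₂ (h v∈T))) FP
      ... | no  i≢m  = classes i T (λ {v} v∈T → case h v∈T of λ (v∈X , cv≡i) →
              case earlier (λ cv≡m → i≢m (trans (≡-sym cv≡i) cv≡m)) of λ (v∉P , cv≡) →
                x∈p∧x∉q⇒x∈p─q v∈X v∉P , trans (≡-sym cv≡) cv≡i)

    Classes⇒Col : ∀ m X → Classes X m → Col m X
    Classes⇒Col zero    X (c , c< , classes) (v , v∈X) = case c< v∈X of λ ()
    Classes⇒Col (suc m) X (c , c< , classes) = P , classes m P (∈-subsetOf⁻ P?) ,
      Classes⇒Col m (X ─ P) (c , c<′ , λ i T h → classes i T (λ v∈T → p─q⊆p X P (proj₁ (h v∈T)) , proj₂ (h v∈T)))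
      where
      P? : ∀ v → Dec (v ∈ X × c v ≡ m)
      P? v = (v ∈? X) ×-dec (c v ≟ℕ m)
      P = subsetOf P?
      c<′ : ∀ {v} → v ∈ X ─ P → c v < m
      c<′ v∈ = ≤∧≢⇒< (s≤s⁻¹ (c< (p─q⊆p X P v∈)))
                     (λ cv≡m → x∈p─q⇒x∉q X P v∈ (∈-subsetOf⁺ P? (p─q⊆p X P v∈ , cv≡m)))

-- Vertex sets and edge multiplicities of multigraphs.

vertices : ∀ {n} → MGraph n → Subset n
vertices M = tabulate (vs M)

∈-vertices⁺ : ∀ {n} (M : MGraph n) {v} → v ∈V M → v ∈ vertices M
∈-vertices⁺ M {v} v∈ = lookup⇒[]= v _ (trans (lookup∘tabulate (vs M) v) v∈)

∈-vertices⁻ : ∀ {n} (M : MGraph n) {v} → v ∈ vertices M → v ∈V M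
∈-vertices⁻ M {v} v∈ = trans (≡-sym (lookup∘tabulate (vs M) v)) ([]=⇒lookup v∈)

∧-true⁻ : ∀ {a b} → a ∧ b ≡ true → a ≡ true × b ≡ true
∧-true⁻ {true} eq = refl , eq

em-∈ : ∀ {n} (M : MGraph n) {u v} → u ∈V M → v ∈V M → em M u v ≡ mult M u v
em-∈ M u∈ v∈ rewrite u∈ | v∈ = refl

em-∉ˡ : ∀ {n} (M : MGraph n) {u v} → ¬ (u ∈V M) → em M u v ≡ 0
em-∉ˡ M {u} u∉ with vs M u
... | true  = contradiction refl u∉
... | false = refl

em-sym : ∀ {n} (M : MGraph n) u v → em M u v ≡ em M v u
em-sym M u v with vs M u | vs M v
... | true  | true  = sym M u v
... | true  | false = refl
... | false | true  = refl
... | false | false = refl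

em-∉ʳ : ∀ {n} (M : MGraph n) {u v} → ¬ (v ∈V M) → em M u v ≡ 0
em-∉ʳ M {u} {v} v∉ = trans (em-sym M u v) (em-∉ˡ M v∉)

em≤mult : ∀ {n} (M : MGraph n) u v → em M u v ≤ mult M u v
em≤mult M u v with vs M u ∧ vs M v
... | true  = ≤-refl
... | false = z≤n

⊆G-intro : ∀ {n} (H M : MGraph n) → (∀ v → v ∈V H → v ∈V M) → (∀ u v → mult H u v ≤ mult M u v) → H ⊆G M
⊆G-intro H M vs⊆ mult≤ = vs⊆ , em≤
  where
  em≤ : ∀ u v → em H u v ≤ em M u v
  em≤ u v with vs H u in u∈ | vs H v in v∈
  ... | true  | true  = ≤-trans (mult≤ u v) (≤-reflexive (≡-sym (em-∈ M (vs⊆ u u∈) (vs⊆ v v∈))))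
  ... | true  | false = z≤n
  ... | false | _     = z≤n

induced⊆G : ∀ {n} (M : MGraph n) Q → induced M Q ⊆G M
induced⊆G M Q = ⊆G-intro (induced M Q) M (λ v v∈ → proj₁ (∧-true⁻ v∈)) (λ _ _ → ≤-refl)

≡ᵇ-true⁺ : ∀ {m n} → m ≡ n → (m ≡ᵇ n) ≡ true
≡ᵇ-true⁺ {m} {n} eq = Equivalence.to T-≡ (≡⇒≡ᵇ m n eq)

≡ᵇ-true⁻ : ∀ {m n} → (m ≡ᵇ n) ≡ true → m ≡ n
≡ᵇ-true⁻ {m} {n} eq = ≡ᵇ⇒≡ m n (Equivalence.from T-≡ eq)

-- Translation between `Colorable` and `Col`.

module Colouring {n : ℕ} (t : ℕ) (1≤t : 1 ≤ t) where

  open Sparsity {n} t 1≤t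

  degenerate⇒sparse : ∀ (M : MGraph n) T → (∀ {v} → v ∈ T → v ∈V M) → StrictlyDegenerate t M → Sparse (mult M) T
  degenerate⇒sparse M T T⊆M sd S S⊆T (x , x∈S)
    with sd H (⊆G-intro H M (λ v v∈ → T⊆M (S⊆T (lookup⇒[]= v S v∈))) (λ _ _ → ≤-refl)) (x , []=⇒lookup x∈S)
    where
    H : MGraph n
    H = record { vs = lookup S ; mult = mult M ; sym = sym M ; loopless = loopless M }
  ... | v , v∈H , deg<t = v , lookup⇒[]= v S v∈H , ≤-trans (s≤s (≤-reflexive (ΣFin-cong same))) deg<t
    where
    same : ∀ u → restrict S (mult M v) u ≡ (if lookup S v ∧ lookup S u then mult M v u else 0)
    same u rewrite v∈H = refl

  sparse⇒degenerate : ∀ (M : MGraph n) → Sparse (mult M) (vertices M) → StrictlyDegenerate t M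
  sparse⇒degenerate M sp H (vs⊆ , em≤) (x , x∈H)
    with sp (vertices H) (λ {v} v∈ → ∈-vertices⁺ M (vs⊆ v (∈-vertices⁻ H v∈))) (x , ∈-vertices⁺ H x∈H)
  ... | v , v∈ , lt = v , ∈-vertices⁻ H v∈ , ≤-trans (s≤s (ΣFin-mono below)) lt
    where
    below : ∀ u → em H v u ≤ restrict (vertices H) (mult M v) u
    below u with u ∈? vertices H
    ... | yes u∈ = ≤-trans (em≤ v u) (≤-trans (em≤mult M v u) (≤-reflexive (≡-sym (restrict-∈ (mult M v) u∈))))
    ... | no  u∉ = ≤-trans (≤-reflexive (em-∉ʳ H (u∉ ∘ ∈-vertices⁺ H))) z≤n

  module Graph (M : MGraph n) where
    open Weighted (mult M) (loopless M) public

  -- `weaken` allows a colouring of a graph with reduced multiplicities to be read as a colouring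
  -- for the original multiplicities `w`.
  colorable⇒Col : ∀ (M : MGraph n) m w (irr : ∀ v → w v v ≡ 0) → (∀ T → Sparse (mult M) T → Sparse w T) →
                  Colorable t M m → Weighted.Col w irr m (vertices M)
  colorable⇒Col M m w irr weaken (c , c< , sd) = Weighted.Classes⇒Col w irr m (vertices M)
    ( c , (λ {v} v∈ → c< v (∈-vertices⁻ M v∈))
    , λ i T h → weaken T (degenerate⇒sparse (induced M (λ v → c v ≡ᵇ i)) T (λ {v} v∈T →
        cong₂ _∧_ (∈-vertices⁻ M (proj₁ (h v∈T))) (≡ᵇ-true⁺ (proj₂ (h v∈T)))) (sd i)))

  Col⇒colorable : ∀ (M : MGraph n) m → Graph.Col M m (vertices M) → Colorable t M m
  Col⇒colorable M m col with Graph.Col⇒Classes M m (vertices M) col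
  ... | c , c< , classes = c , (λ v v∈ → c< (∈-vertices⁺ M v∈)) , λ i →
    sparse⇒degenerate (induced M (λ v → c v ≡ᵇ i)) (classes i _ (λ {v} v∈ →
      case ∧-true⁻ (∈-vertices⁻ (induced M (λ v → c v ≡ᵇ i)) v∈) of λ (v∈M , cv) → ∈-vertices⁺ M v∈M , ≡ᵇ-true⁻ cv))

  -- Only a vertex of weighted degree < t matters, and all multiplicities at it are then below the cap t.
  uncap : ∀ (w : Fin n → Fin n → ℕ) T → Sparse (λ u v → w u v ⊓ t) T → Sparse w T
  uncap w T sp S S⊆T ne with sp S S⊆T ne
  ... | v , v∈S , lt = v , v∈S , ≤-<-trans (sumOn-mono below) lt
    where
    below : ∀ {u} → u ∈ S → w v u ≡ 0 ⊎ u ∈ S × w v u ≤ w v u ⊓ t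
    below {u} u∈S with w v u ≤? t
    ... | yes w≤t = inj₂ (u∈S , ≤-reflexive (≡-sym (m≤n⇒m⊓n≡m w≤t)))
    ... | no  w≰t = contradiction lt (≤⇒≯ (begin
        t                                      ≡⟨ m≥n⇒m⊓n≡n (<⇒≤ (≰⇒> w≰t)) ⟨
        w v u ⊓ t                              ≡⟨ restrict-∈ (λ u → w v u ⊓ t) u∈S ⟨
        restrict S (λ u → w v u ⊓ t) u         ≤⟨ term≤ΣFin (restrict S (λ u → w v u ⊓ t)) u ⟩
        sumOn S (λ u → w v u ⊓ t)              ∎))
      where open ≤-Reasoning

  -- Vertex-criticality, multiplicities and single vertices of a critical graph.

  module Critical (G : MGraph n) (full : ∀ v → vs G v ≡ true) (κ : ℕ) (cri : Cri t (suc κ) G) where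

    open Graph G

    ¬Col-⊤ : ¬ Col κ ⊤
    ¬Col-⊤ col = proj₂ (proj₁ cri) κ ≤-refl (Col⇒colorable G κ (Col-⊆ κ ⊆⊤ col))

    delete : Fin n → MGraph n
    delete x = induced G (λ v → not (does (v ≟ x)))

    ∈-delete⁺ : ∀ {x v} → v ≢ x → v ∈V delete x
    ∈-delete⁺ {x} {v} v≢x with v ≟ x
    ... | yes v≡x = contradiction v≡x v≢x
    ... | no  _   = cong (_∧ true) (full v)

    ∈-delete⁻ : ∀ {x v} → v ∈V delete x → v ≢ x
    ∈-delete⁻ {x} {v} v∈ v≡x with v ≟ x
    ... | yes _   = case proj₂ (∧-true⁻ {vs G v} v∈) of λ ()
    ... | no  v≢x = v≢x v≡x

    crit-⊤ : Crit κ ⊤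
    crit-⊤ = ¬Col-⊤ , λ {x} _ → colx x
      where
      colx : ∀ x → Col κ (⊤ - x)
      colx x with proj₂ cri (delete x) (induced⊆G G _ , λ (vs⊆ , _) → ∈-delete⁻ (vs⊆ x (full x)) refl)
      ... | j , j<k , colorable , _ = Col-≤ (s≤s⁻¹ j<k) (Col-⊆ j (λ v∈ → ∈-vertices⁺ (delete x) (∈-delete⁺ (x∈p-y⇒x≢y ⊤ v∈)))
              (colorable⇒Col (delete x) j (mult G) (loopless G) (λ _ sp → sp) colorable))

    capped : MGraph n
    capped = record { vs = vs G ; mult = λ u v → mult G u v ⊓ t
                    ; sym = λ u v → cong (_⊓ t) (sym G u v) ; loopless = λ v → cong (_⊓ t) (loopless G v) }

    -- If a multiplicity exceeded `t`, `capped` would be a proper subgraph and have a colouring with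
    -- `κ` colours. By `uncap` its classes are sparse in `G` as well, against `¬Col-⊤`.
    mult≤t : ∀ x y → mult G x y ≤ t
    mult≤t x y = ≮⇒≥ λ t<m → case proj₂ cri capped (capped⊂ t<m) of λ (j , j<k , colorable , _) →
      ¬Col-⊤ (Col-≤ (s≤s⁻¹ j<k) (Col-⊆ j (λ {v} _ → ∈-vertices⁺ capped (full v))
        (colorable⇒Col capped j (mult G) (loopless G) (uncap (mult G)) colorable)))
      where
      capped⊂ : t < mult G x y → capped ⊂G G
      capped⊂ t<m = ⊆G-intro capped G (λ _ v∈ → v∈) (λ u v → m⊓n≤m _ t) , λ (_ , em≤) → <⇒≱ t<m (begin
        mult G x y       ≡⟨ em-∈ G (full x) (full y) ⟨
        em G x y         ≤⟨ em≤ x y ⟩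
        em capped x y    ≤⟨ em≤mult capped x y ⟩
        mult G x y ⊓ t   ≤⟨ m⊓n≤n _ t ⟩
        t                ∎)
        where open ≤-Reasoning

    only : Fin n → MGraph n
    only x = induced G (λ v → does (v ≟ x))

    ∈-only⁺ : ∀ x → x ∈V only x
    ∈-only⁺ x with x ≟ x
    ... | yes _   = cong (_∧ true) (full x)
    ... | no  x≢x = contradiction refl x≢x

    ∈-only⁻ : ∀ {x v} → v ∈V only x → v ≡ x
    ∈-only⁻ {x} {v} v∈ with v ≟ x
    ... | yes v≡x = v≡x
    ... | no  _   = case proj₂ (∧-true⁻ {vs G v} v∈) of λ ()

    cri-only : ∀ x → Cri t 1 (only x)
    cri-only x = (Col⇒colorable (only x) 1 col₁ , λ { zero _ (c , c< , _) → case c< x (∈-only⁺ x) of λ () ; (suc j) (s≤s ()) }) , proper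
      where
      col₁ : Graph.Col (only x) 1 (vertices (only x))
      col₁ = ⁅ x ⁆ , sparse-⁅⁆ (mult G) (loopless G) x , λ (v , v∈) →
        x∈p-y⇒x≢y (vertices (only x)) v∈ (∈-only⁻ (∈-vertices⁻ (only x) (p─q⊆p _ ⁅ x ⁆ v∈)))
      em-only : ∀ u v → em (only x) u v ≡ 0
      em-only u v with vs (only x) u in u∈ | vs (only x) v in v∈
      ... | true  | true  = trans (cong₂ (mult G) (∈-only⁻ u∈) (∈-only⁻ v∈)) (loopless G x)
      ... | true  | false = refl
      ... | false | _     = refl
      proper : ∀ H → H ⊂G only x → ∃ λ j → j < 1 × ChiEq t H j
      -- A single vertex carries no edges, so a proper subgraph of it has no vertices and chromatic
      -- number 0.
      proper H ((vs⊆ , _) , ¬⊇) = 0 , s≤s z≤n , Col⇒colorable H 0 empty , λ _ ()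
        where
        empty : ¬ Nonempty (vertices H)
        empty (v , v∈) = ¬⊇ ((λ u u∈ → subst (_∈V H) (trans (∈-only⁻ (vs⊆ v v∈H)) (≡-sym (∈-only⁻ u∈))) v∈H) ,
                             λ u v → ≤-trans (≤-reflexive (em-only u v)) z≤n)
          where
          v∈H : v ∈V H
          v∈H = ∈-vertices⁻ H v∈

    dominating-only : ∀ x y → y ≢ x → (∀ {v} → v ≢ x → mult G x v ≡ t) → Dominating t G (only x)
    dominating-only x y y≢x mult≡t = induced⊆G G _ , (x , ∈-only⁺ x) ,
      delete x , induced⊆G G _ , (y , ∈-delete⁺ y≢x) ,
      (λ v v∈ v∈′ → ∈-delete⁻ v∈′ (∈-only⁻ v∈)) , cover , (λ v _ → full v) ,
      (λ u v u∈ v∈ → trans (em-∈ G (full u) (full v)) (≡-sym (em-∈ (only x) u∈ v∈))) ,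
      (λ u v u∈ v∈ → trans (em-∈ G (full u) (full v)) (≡-sym (em-∈ (delete x) u∈ v∈))) ,
      λ u v u∈ v∈ → trans (em-∈ G (full u) (full v))
        (trans (cong (λ z → mult G z v) (∈-only⁻ u∈)) (mult≡t (∈-delete⁻ v∈)))
      where
      cover : ∀ v → v ∈V G → v ∈V only x ⊎ v ∈V delete x
      cover v _ with v ≟ x
      ... | yes refl = inj₁ (cong (_∧ true) (full v))
      ... | no  v≢x  = inj₂ (cong (_∧ true) (full v))

-- Degree sums and binomial coefficients.

-- `e` counts a pair from its smaller end, so an ordered pair is covered by `up` in one of the two
-- orientations; diagonal pairs contribute 0 by looplessness.
handshake : ∀ {n} (G : MGraph n) → ΣFin (deg G) ≤ e G + e G
handshake G = begin
  ΣFin (λ u → ΣFin (em G u))                                     ≤⟨ ΣFin-mono (λ u → ΣFin-mono (oriented u)) ⟩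
  ΣFin (λ u → ΣFin (λ v → up u v + up v u))                      ≡⟨ ΣFin-cong (λ u → ΣFin-+ (up u) (λ v → up v u)) ⟩
  ΣFin (λ u → ΣFin (up u) + ΣFin (λ v → up v u))                 ≡⟨ ΣFin-+ (λ u → ΣFin (up u)) (λ u → ΣFin (λ v → up v u)) ⟩
  e G + ΣFin (λ u → ΣFin (λ v → up v u))                         ≡⟨ cong (e G +_) (ΣFin-swap (λ u v → up v u)) ⟩
  e G + e G                                                      ∎
  where
  open ≤-Reasoning
  up : _ → _ → ℕ
  up u v = if toℕ u <ᵇ toℕ v then em G u v else 0
  oriented : ∀ u v → em G u v ≤ up u v + up v u
  oriented u v with toℕ u <ᵇ toℕ v in u<v | toℕ v <ᵇ toℕ u in v<u
  ... | true  | _     = m≤m+n _ _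
  ... | false | true  = ≤-reflexive (em-sym G u v)
  ... | false | false = ≤-trans (em≤mult G u v) (≤-reflexive (trans (cong (mult G u) (≡-sym u≡v)) (loopless G u)))
    where
    ≥-of : ∀ a b → (a <ᵇ b) ≡ false → b ≤ a
    ≥-of a b eq = ≮⇒≥ (λ a<b → subst T eq (<⇒<ᵇ a<b))
    u≡v : u ≡ v
    u≡v = toℕ-injective (≤-antisym (≥-of _ _ v<u) (≥-of _ _ u<v))

2*nC2 : ∀ m → 2 * (suc m C 2) ≡ suc m * m
2*nC2 zero    = refl
2*nC2 (suc m) = begin
  2 * (suc (suc m) C 2)             ≡⟨ cong (2 *_) (nCk+nC[k+1]≡[n+1]C[k+1] (suc m) 1) ⟨
  2 * (suc m C 1 + suc m C 2)       ≡⟨ *-distribˡ-+ 2 (suc m C 1) (suc m C 2) ⟩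
  2 * (suc m C 1) + 2 * (suc m C 2) ≡⟨ cong₂ _+_ (cong (2 *_) (nC1≡n (suc m))) (2*nC2 m) ⟩
  2 * suc m + suc m * m             ≡⟨ cong (_+ suc m * m) (*-comm 2 (suc m)) ⟩
  suc m * 2 + suc m * m             ≡⟨ *-distribˡ-+ (suc m) 2 m ⟨
  suc m * (2 + m)                   ≡⟨ *-comm (suc m) (2 + m) ⟩
  suc (suc m) * suc m               ∎
  where open ≡-Reasoning

-- Counting degrees along the decomposition.

module DegreeCount {n t : ℕ} (1≤t : 1 ≤ t) (G : MGraph n) (full : ∀ v → vs G v ≡ true) where

  open Sparsity {n} t 1≤t
  open Colouring {n} t 1≤t
  open Graph G

  -- Criticality inside `X` yields the first summand. A vertex outside `X` is not linked to `v`,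
  -- hence joined to it by at least `t` edges.
  Crit⇒deg≥ : ∀ {κ X v} → Crit κ X → NoCross X (⊤ ─ X) → v ∈ X → κ * t + ∣ ⊤ ─ X ∣ * t ≤ deg G v
  Crit⇒deg≥ {κ} {X} {v} crit nc v∈X = begin
    κ * t + ∣ ⊤ ─ X ∣ * t                              ≡⟨ cong (κ * t +_) (sumOn-const (⊤ ─ X) t) ⟨
    κ * t + sumOn (⊤ ─ X) (λ _ → t)                    ≤⟨ +-mono-≤ (Crit⇒κ*t≤ crit v∈X) (sumOn-mono (λ u∈ →
                                                            inj₂ (u∈ , ¬Linked⇒t≤ (nc v∈X u∈ ∘ Linked-sym)))) ⟩
    sumOn (X - v) (mult G v) + sumOn (⊤ ─ X) (mult G v) ≤⟨ disjoint⇒sumOn-+ (X - v) (⊤ ─ X) ⊤ (mult G v) ⊆⊤ ⊆⊤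
                                                            (λ u∈ u∈′ → x∈p─q⇒x∉q ⊤ X u∈′ (p─q⊆p X ⁅ v ⁆ u∈)) ⟩
    sumOn ⊤ (mult G v)                                 ≡⟨ ΣFin-cong (λ u → trans (restrict-∈ (mult G v) (∈⊤ {x = u})) (≡-sym (em-∈ G (full v) (full u)))) ⟩
    deg G v                                            ∎
    where open ≤-Reasoning

  module _ (κ p : ℕ) (n≡ : n ≡ suc κ + p) (p+2≤ : p + 2 ≤ suc κ) (crit-⊤ : Crit κ ⊤)
           (D : Decomposition ⊤) (noSingleton : ∀ {X} → Crit 0 X → ¬ NoCross X (⊤ ─ X)) where

    private module D = Decomposition D

    open ≤-Reasoning

    -- The subtraction in `excess` is never truncated, because `large` makes every part at least as
    -- big as its chromatic number.
    size excess : Fin D.parts → ℕ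
    size i = ∣ D.part i ∣
    excess i = size i ∸ suc (D.κ i)

    part-closed : ∀ i → NoCross (D.part i) (⊤ ─ D.part i)
    part-closed i u∈ w∈ = case D.cover ∈⊤ of λ (j , w∈j) →
      D.apart i j (λ { refl → x∈p─q⇒x∉q ⊤ (D.part i) w∈ w∈j }) u∈ w∈j

    size≡ : ∀ i → suc (D.κ i) + excess i ≡ size i
    size≡ i = m+[n∸m]≡n (≤-trans (m≤n+m _ (D.κ i)) (D.large i))

    κ≤excess : ∀ i → D.κ i ≤ excess i
    κ≤excess i = +-cancelˡ-≤ (suc (D.κ i)) _ _ (begin
      suc (D.κ i) + D.κ i     ≡⟨ +-comm (suc (D.κ i)) _ ⟩
      D.κ i + suc (D.κ i)     ≤⟨ D.large i ⟩
      size i                  ≡⟨ size≡ i ⟨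
      suc (D.κ i) + excess i  ∎)

    -- A part with `D.κ i` equal to 0 would be a single vertex not linked to any other, which
    -- `noSingleton` forbids; otherwise `κ≤excess` applies.
    1≤excess : ∀ i → 1 ≤ excess i
    1≤excess i = ≤-trans (n≢0⇒n>0 (λ κ≡0 → noSingleton (subst (λ m → Crit m (D.part i)) κ≡0 (D.crit i)) (part-closed i)))
                         (κ≤excess i)

    ∣⊤∣≡ : ∣ ⊤ {n} ∣ ≡ suc κ + p
    ∣⊤∣≡ = trans (∣⊤∣≡n n) n≡

    k≤colours : suc κ ≤ ΣFin (suc ∘ D.κ)
    k≤colours = ¬Col⇒≤colours D (proj₁ crit-⊤)

    -- With k = `suc κ`, `doubled` gives 2k ≤ n + parts = k + p + parts, while p + 2 ≤ k.
    2≤parts : 2 ≤ D.parts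
    2≤parts = +-cancelˡ-≤ p _ _ (≤-trans p+2≤ (+-cancelˡ-≤ (suc κ) _ _ (begin
      suc κ + suc κ                       ≤⟨ +-mono-≤ k≤colours k≤colours ⟩
      ΣFin (suc ∘ D.κ) + ΣFin (suc ∘ D.κ) ≤⟨ doubled D ⟩
      ∣ ⊤ {n} ∣ + D.parts                 ≡⟨ cong (_+ D.parts) ∣⊤∣≡ ⟩
      suc κ + p + D.parts                 ≡⟨ +-assoc (suc κ) p D.parts ⟩
      suc κ + (p + D.parts)               ∎)))

    Σexcess≤p : ΣFin excess ≤ p
    Σexcess≤p = +-cancelˡ-≤ (suc κ) _ _ (begin
      suc κ + ΣFin excess               ≤⟨ +-monoˡ-≤ _ k≤colours ⟩
      ΣFin (suc ∘ D.κ) + ΣFin excess    ≡⟨ ΣFin-+ (suc ∘ D.κ) excess ⟨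
      ΣFin (λ i → suc (D.κ i) + excess i) ≡⟨ ΣFin-cong size≡ ⟩
      ΣFin size                         ≤⟨ D.sizes ⟩
      ∣ ⊤ {n} ∣                         ≡⟨ ∣⊤∣≡ ⟩
      suc κ + p                         ∎)

    -- Another part contributes at least 1 to the total excess p.
    excess<p : ∀ i → suc (excess i) ≤ p
    excess<p i = s≤s⁻¹ (begin
      2 + excess i          ≡⟨ +-comm 2 _ ⟩
      excess i + 2          ≤⟨ +-monoʳ-≤ (excess i) 2≤parts ⟩
      excess i + D.parts    ≤⟨ positive-term+n≤ΣFin excess 1≤excess i ⟩
      suc (ΣFin excess)     ≤⟨ s≤s Σexcess≤p ⟩
      suc p                 ∎)

    size≤2p : ∀ i → size i ≤ p + p
    size≤2p i = begin
      size i                    ≡⟨ size≡ i ⟨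
      suc (D.κ i) + excess i    ≤⟨ +-mono-≤ (≤-trans (s≤s (κ≤excess i)) (excess<p i)) (<⇒≤ (excess<p i)) ⟩
      p + p                     ∎

    -- Here `κ + p` is n - 1. The deficit is written as a sum over all parts, in which the term of
    -- the part containing `v` suffices, so that the order of summation can later be exchanged.
    deficit≤ : ∀ v → t * (κ + p) ≤ deg G v + ΣFin (λ i → restrict (D.part i) (λ _ → t * excess i) v)
    deficit≤ v with D.cover (∈⊤ {x = v})
    ... | i , v∈i = begin
      t * (κ + p)                                              ≡⟨ cong (t *_) κ+p≡ ⟩
      t * (D.κ i + ∣ ⊤ ─ D.part i ∣ + excess i)                ≡⟨ *-distribˡ-+ t _ (excess i) ⟩
      t * (D.κ i + ∣ ⊤ ─ D.part i ∣) + t * excess i            ≡⟨ cong (_+ t * excess i) (trans (*-comm t _) (*-distribʳ-+ t (D.κ i) _)) ⟩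
      D.κ i * t + ∣ ⊤ ─ D.part i ∣ * t + t * excess i          ≤⟨ +-mono-≤ (Crit⇒deg≥ (D.crit i) (part-closed i) v∈i)
                                                                    (≤-reflexive (≡-sym (restrict-∈ (λ _ → t * excess i) v∈i))) ⟩
      deg G v + restrict (D.part i) (λ _ → t * excess i) v     ≤⟨ +-monoʳ-≤ (deg G v) (term≤ΣFin (λ i → restrict (D.part i) (λ _ → t * excess i) v) i) ⟩
      deg G v + ΣFin (λ i → restrict (D.part i) (λ _ → t * excess i) v) ∎
      where
      rest = ∣ ⊤ ─ D.part i ∣
      -- For part `i` this says n - 1 = (k_i - 1) + (n - n_i) + p_i.
      κ+p≡ : κ + p ≡ D.κ i + rest + excess i
      κ+p≡ = suc-injective (≤-antisym
        (begin
          suc (κ + p)                         ≡⟨ ∣⊤∣≡ ⟨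
          ∣ ⊤ {n} ∣                           ≤⟨ ∣p∣≤∣q∣+∣p─q∣ ⊤ (D.part i) ⟩
          size i + rest                       ≡⟨ shuffle ⟩
          suc (D.κ i + rest + excess i)       ∎)
        (begin
          suc (D.κ i + rest + excess i)       ≡⟨ shuffle ⟨
          size i + rest                       ≤⟨ q⊆p⇒∣q∣+∣p─q∣≤∣p∣ ⊤ (D.part i) ⊆⊤ ⟩
          ∣ ⊤ {n} ∣                           ≡⟨ ∣⊤∣≡ ⟩
          suc (κ + p)                         ∎))
        where
        shuffle : size i + rest ≡ suc (D.κ i + rest + excess i)
        shuffle = trans (cong (_+ rest) (≡-sym (size≡ i))) (cong suc (trans (+-assoc (D.κ i) (excess i) rest)
          (trans (cong (D.κ i +_) (+-comm (excess i) rest)) (≡-sym (+-assoc (D.κ i) rest (excess i))))))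

    Σdeficit≤ : ΣFin (λ i → size i * (t * excess i)) ≤ (p + p) * (t * p)
    Σdeficit≤ = begin
      ΣFin (λ i → size i * (t * excess i))     ≤⟨ ΣFin-mono (λ i → *-monoˡ-≤ (t * excess i) (size≤2p i)) ⟩
      ΣFin (λ i → (p + p) * (t * excess i))    ≡⟨ ΣFin-*ˡ (p + p) (λ i → t * excess i) ⟩
      (p + p) * ΣFin (λ i → t * excess i)      ≡⟨ cong ((p + p) *_) (ΣFin-*ˡ t excess) ⟩
      (p + p) * (t * ΣFin excess)              ≤⟨ *-monoʳ-≤ (p + p) (*-monoʳ-≤ t Σexcess≤p) ⟩
      (p + p) * (t * p)                        ∎

    -- After the exchange of sums, part `i` contributes `t * excess i` once for each of its
    -- vertices.
    degreeSum≥ : n * (t * (κ + p)) ≤ e G + e G + (p + p) * (t * p)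
    degreeSum≥ = begin
      n * (t * (κ + p))
        ≡⟨ ΣFin-const n _ ⟨
      ΣFin {n} (λ _ → t * (κ + p))
        ≤⟨ ΣFin-mono deficit≤ ⟩
      ΣFin (λ v → deg G v + ΣFin (λ i → restrict (D.part i) (λ _ → t * excess i) v))
        ≡⟨ ΣFin-+ (deg G) _ ⟩
      ΣFin (deg G) + ΣFin (λ v → ΣFin (λ i → restrict (D.part i) (λ _ → t * excess i) v))
        ≡⟨ cong (ΣFin (deg G) +_) (trans (ΣFin-swap (λ v i → restrict (D.part i) (λ _ → t * excess i) v))
                                         (ΣFin-cong (λ i → sumOn-const (D.part i) (t * excess i)))) ⟩
      ΣFin (deg G) + ΣFin (λ i → size i * (t * excess i))
        ≤⟨ +-mono-≤ (handshake G) Σdeficit≤ ⟩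
      e G + e G + (p + p) * (t * p) ∎

-- The edge bound.

theorem26 : (t k n p : ℕ) → 1 ≤ t → n ≡ k + p → 2 ≤ p → p + 2 ≤ k →
    (G : MGraph n) → (∀ v → vs G v ≡ true) → Cri t k G →
    (∀ H → Dominating t G H → ¬ (Cri t 1 H ⊎ Cri t 2 H)) →
    t * (n C 2) ≤ e G + t * (p ^ 2)
theorem26 t zero    n p 1≤t n≡ 2≤p p+2≤k G full cri noDom = contradiction (≤-trans (m≤n+m 2 p) p+2≤k) (λ ())
-- Both sides are doubled, which clears the binomial coefficient and fits the handshake count.
theorem26 t (suc κ) n p 1≤t refl 2≤p p+2≤k G full cri noDom = *-cancelˡ-≤ 2 (begin
  2 * (t * (n C 2))                ≡⟨ x∙yz≈y∙xz 2 t (n C 2) ⟩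
  t * (2 * (n C 2))                ≡⟨ cong (t *_) (2*nC2 (κ + p)) ⟩
  t * (n * (κ + p))                ≡⟨ x∙yz≈y∙xz t n (κ + p) ⟩
  n * (t * (κ + p))                ≤⟨ degreeSum≥ κ p refl p+2≤k crit-⊤ (decomposition crit-⊤) noSingleton ⟩
  e G + e G + (p + p) * (t * p)    ≡⟨ solve 3 (λ e t p → e :+ e :+ (p :+ p) :* (t :* p) := con 2 :* (e :+ t :* (p :^ 2))) refl (e G) t p ⟩
  2 * (e G + t * (p ^ 2))          ∎)
  where
  open ≤-Reasoning
  open DegreeCount 1≤t G full
  open Colouring {n} t 1≤t
  open Critical G full κ cri
  open Graph G
  -- For `Crit 0 X`, removing `x` leaves nothing, so `X` consists of `x` alone. Having no links
  -- gives at least `t` edges to every other vertex and `mult≤t` at most `t`, so `only x` is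
  -- dominating.
  noSingleton : ∀ {X} → Crit 0 X → ¬ NoCross X (⊤ ─ X)
  noSingleton {X} crit nc with Crit⇒Nonempty crit
  ... | x , x∈X = noDom (only x) (dominating-only x y (x∈p-y⇒x≢y ⊤ y∈) mult≡t) (inj₁ (cri-only x))
    where
    v∉X : ∀ {v} → v ≢ x → v ∉ X
    v∉X v≢x v∈X = proj₂ crit x∈X (_ , x∈p∧x≢y⇒x∈p-y v∈X v≢x)
    mult≡t : ∀ {v} → v ≢ x → mult G x v ≡ t
    mult≡t {v} v≢x = ≤-antisym (mult≤t x v)
      (¬Linked⇒t≤ (nc x∈X (x∈p∧x∉q⇒x∈p─q ∈⊤ (v∉X v≢x)) ∘ Linked-sym))
    ∃y : Nonempty (⊤ - x)
    ∃y = 1≤∣p∣⇒Nonempty (⊤ - x) (s≤s⁻¹ (begin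
      2                        ≤⟨ 2≤p ⟩
      p                        ≤⟨ m≤n+m p (suc κ) ⟩
      suc κ + p                ≡⟨ ∣⊤∣≡n n ⟨
      ∣ ⊤ {n} ∣                ≤⟨ ∣p∣≤∣q∣+∣p─q∣ ⊤ ⁅ x ⁆ ⟩
      ∣ ⁅ x ⁆ ∣ + ∣ ⊤ - x ∣    ≡⟨ cong (_+ ∣ ⊤ - x ∣) (∣⁅x⁆∣≡1 x) ⟩
      suc ∣ ⊤ - x ∣            ∎))
    y = proj₁ ∃y
    y∈ = proj₂ ∃y
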